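{- Let $D$ be a skeletal directed acyclic graph. The canonical join complex of $\mathcal{AR}_D$ is isomorphic, as a simplicial complex, to the non-crossing rope complex of $D$. The canonical meet complex of $\mathcal{AR}_D$ is also isomorphic to the non-crossing rope complex of $D$.
   Context: All directed graphs are finite and simple. A reorientation of a directed acyclic graph $D=(V,A)$ is a directed graph with the same underlying undirected graph, encoded by the set of arcs of $D$ that it reverses. $\mathcal{AR}_D$ is the poset of acyclic reorientations of $D$ ordered by inclusion of sets of reversed arcs. The transitive reduction of a directed acyclic graph is obtained by deleting all arcs whose endpoints are connected by a directed path of length at least $2$. A directed graph is a forest if its underlying undirected graph has no cycle. $D$ is vertebrate if the transitive reduction of every induced subgraph of $D$ is a forest; filled if for any directed path $\pi$ in $D$ whose endpoints are joined by an arc of $D$, all arcs joining any two vertices of $\pi$ belong to $D$; skeletal if vertebrate and filled. When $D$ is skeletal, $\mathcal{AR}_D$ is a semidistributive lattice, so canonical join and meet representations exist. A join representation of an element $x$ of a finite lattice $L$ is a subset $J\subseteq L$ with $x=\bigvee J$; it is irredundant if $x\ne\bigvee J'$ for every strict subset $J'\subsetneq J$. Irredundant join representations of $x$ are ordered by $J\le J'$ if for any $y\in J$ there is $y'\in J'$ with $y\le y'$. The canonical join representation of $x$ is the minimal irredundant join representation for this order. Canonical meet representations are defined dually. The canonical join (resp. meet) complex of a semidistributive lattice $L$ is the simplicial complex on the join (resp. meet) irreducible elements of $L$ whose faces are the canonical join (resp. meet) representations of the elements of $L$. The transitive support of an arc $(u,v)$ of $D$ is the set of vertices appearing along directed paths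 in $D$ from $u$ to $v$. A rope of $D$ is a quadruple $(u,v,\nabla,\Delta)$ where $(u,v)\in A$ and $\nabla\sqcup\Delta$ is a partition of the transitive support of $(u,v)$ minus $\{u,v\}$. Two ropes $(u,v,\nabla,\Delta)$ and $(u',v',\nabla',\Delta')$ are crossing if there are distinct vertices $w\ne w'$ such that $w\in(\nabla\cup\{u,v\})\cap(\Delta'\cup\{u',v'\})$ and $w'\in(\Delta\cup\{u,v\})\cap(\nabla'\cup\{u',v'\})$. A non-crossing rope diagram is a set of ropes of $D$ any two distinct of which are non-crossing. The non-crossing rope complex of $D$ is the simplicial complex on the ropes of $D$ whose faces are the non-crossing rope diagrams. -}

module Defs where

open import Data.Fin.Base using (Fin)
open import Data.Fin.Subset using (Subset; _∈_; _⊆_; _∩_; _∪_; ⁅_⁆; Empty)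
open import Data.Fin.Subset.Properties
  using (⊆-reflexive; ⊆-trans; ⊆-antisym)
open import Data.List.Base using (List; []; _∷_; _∷ʳ_; length; map)
import Data.List.Membership.Propositional as List
import Data.List.Membership.Setoid
open import Data.List.Relation.Binary.Subset.Setoid.Properties using (map⁺)
import Data.List.Relation.Binary.Subset.Setoid
open import Data.List.Relation.Unary.All using (All)
open import Data.List.Relation.Unary.Any using (Any)
open import Data.List.Relation.Unary.Linked using (Linked)
open import Data.List.Relation.Unary.Unique.Propositional using (Unique)
open import Data.Nat.Base using (ℕ; suc; _≤_)
open import Data.Product.Base using (∃; ∃₂; _×_; _,_; proj₁)
open import Data.Sum.Base using (_⊎_)
open import Function.Base using (_on_; _∘_)
open import Function.Bundles using (Inverse; _⇔_; Equivalence)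
open import Level using (0ℓ)
open import Relation.Binary.Bundles using (Setoid; Poset)
open import Relation.Binary.Construct.Closure.ReflexiveTransitive
  using (Star; ε; _◅_)
open import Relation.Binary.Construct.Closure.Symmetric using (SymClosure)
open import Relation.Binary.Construct.Closure.Transitive using (TransClosure)
import Relation.Binary.Construct.Flip.EqAndOrd as Flip
import Relation.Binary.Construct.On as On
open import Relation.Binary.Core using (Rel)
open import Relation.Binary.PropositionalEquality.Core
  using (_≡_; _≢_; _≗_; refl; sym; trans)
open import Relation.Binary.PropositionalEquality.Properties using (setoid)
open import Relation.Nullary.Negation using (¬_)

------------------------------------------------------------------------
-- Directed graphs, as relations on their vertices

module _ {V : Set} (_⟶_ : Rel V 0ℓ) where

  Path : Rel V 0ℓ
  Path = Star _⟶_

  vertices : ∀ {u v} → Path u v → List V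
  vertices {u} ε       = u ∷ []
  vertices {u} (_ ◅ π) = u ∷ vertices π

  pathLength : ∀ {u v} → Path u v → ℕ
  pathLength ε       = 0
  pathLength (_ ◅ π) = suc (pathLength π)

  Acyclic : Set
  Acyclic = ∀ v → ¬ TransClosure _⟶_ v v

  -- The underlying undirected graph.
  Adjacent : Rel V 0ℓ
  Adjacent = SymClosure _⟶_

  -- x ∷ xs lists the distinct vertices of a cycle in cyclic order; a
  -- simple graph has no cycle on fewer than three vertices.
  UndirectedCycle : Set
  UndirectedCycle = ∃₂ λ x xs →
    Unique (x ∷ xs) × 3 ≤ length (x ∷ xs) × Linked Adjacent ((x ∷ xs) ∷ʳ x)

  Forest : Set
  Forest = ¬ UndirectedCycle

  TransitiveReduction : Rel V 0ℓ
  TransitiveReduction u v =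
    u ⟶ v × ¬ (∃ λ (π : Path u v) → 2 ≤ pathLength π)

  TransitiveSupport : V → V → V → Set
  TransitiveSupport u v w = ∃ λ (π : Path u v) → w List.∈ vertices π

  Filled : Set
  Filled = ∀ {u v} (π : Path u v) → Adjacent u v →
    ∀ {w w′} → w List.∈ vertices π → w′ List.∈ vertices π →
    w ≢ w′ → Adjacent w w′

induced : ∀ {n} → Rel (Fin n) 0ℓ → (S : Subset n) → Rel (∃ (_∈ S)) 0ℓ
induced _⟶_ S = _⟶_ on proj₁

Vertebrate : ∀ {n} → Rel (Fin n) 0ℓ → Set
Vertebrate _⟶_ = ∀ S → Forest (TransitiveReduction (induced _⟶_ S))

-- A set of ordered pairs (u , v), given by the set of all v for each u.
ArcSet : ℕ → Set
ArcSet n = Fin n → Subset n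

Arc : ∀ {n} → ArcSet n → Rel (Fin n) 0ℓ
Arc A u v = v ∈ A u

-- Acyclicity excludes loops and pairs of opposite arcs, so these graphs
-- are simple.
record DAG : Set where
  field
    n       : ℕ
    arcs    : ArcSet n
    acyclic : Acyclic (Arc arcs)

  V : Set
  V = Fin n

  _⟶_ : Rel V 0ℓ
  _⟶_ = Arc arcs

Skeletal : DAG → Set
Skeletal D = Vertebrate _⟶_ × Filled _⟶_
  where open DAG D

------------------------------------------------------------------------
-- Acyclic reorientations

module _ (D : DAG) where
  open DAG D

  Reorient : ArcSet n → Rel V 0ℓ
  Reorient R u v = (u ⟶ v × ¬ Arc R u v) ⊎ (v ⟶ u × Arc R v u)

  record AcyclicReorientation : Set where
    field
      reversed   : ArcSet n
      reversed⊆  : ∀ u → reversed u ⊆ arcs u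
      reoriented : Acyclic (Reorient reversed)

  open AcyclicReorientation

  AR : Poset 0ℓ 0ℓ 0ℓ
  AR = record
    { Carrier        = AcyclicReorientation
    ; _≈_            = λ x y → reversed x ≗ reversed y
    ; _≤_            = λ x y → ∀ u → reversed x u ⊆ reversed y u
    ; isPartialOrder = record
      { isPreorder = record
        { isEquivalence = record
          { refl  = λ _ → refl
          ; sym   = λ p u → sym (p u)
          ; trans = λ p q u → trans (p u) (q u)
          }
        ; reflexive = λ p u → ⊆-reflexive (p u)
        ; trans     = λ p q u → ⊆-trans (p u) (q u)
        }
      ; antisym = λ p q u → ⊆-antisym (p u) (q u)
      }
    }

------------------------------------------------------------------------
-- Complexes

-- A family of finite subsets of a set of vertices. Finite subsets are
-- given as lists, regardless of order and repetition.
record Complex : Set₁ where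
  field
    Vertices : Setoid 0ℓ 0ℓ
    IsFace   : List (Setoid.Carrier Vertices) → Set

IsSimplicial : Complex → Set
IsSimplicial K = ∀ {S T} → S ⊆ᴸ T → IsFace T → IsFace S
  where
  open Complex K
  open Data.List.Relation.Binary.Subset.Setoid Vertices
    renaming (_⊆_ to _⊆ᴸ_)

infix 4 _≅_

record _≅_ (K L : Complex) : Set where
  private
    module K = Complex K
    module L = Complex L
  field
    vertexMap : Inverse K.Vertices L.Vertices
    faces     : ∀ S → K.IsFace S ⇔ L.IsFace (map (Inverse.to vertexMap) S)

≅-isSimplicial : ∀ {K L} → K ≅ L → IsSimplicial L → IsSimplicial K
≅-isSimplicial {K} {L} K≅L simplicial {S} {T} S⊆T =
  Equivalence.from (faces S) ∘
  simplicial (map⁺ (Complex.Vertices K) (Complex.Vertices L)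
                   (Inverse.to-cong vertexMap) S⊆T) ∘
  Equivalence.to (faces T)
  where open _≅_ K≅L

------------------------------------------------------------------------
-- Canonical representations

-- Everything is expressed by least upper bounds in a poset, so that it
-- makes sense without a chosen join operation. All finite joins exist
-- when the poset is a finite lattice.
module _ (P : Poset 0ℓ 0ℓ 0ℓ) where
  open Poset P using (Carrier) renaming (_≤_ to _≼_)
  private module P = Poset P
  open Data.List.Membership.Setoid P.Eq.setoid
    using () renaming (_∈_ to _∈ᴸ_)
  open Data.List.Relation.Binary.Subset.Setoid P.Eq.setoid
    using () renaming (_⊆_ to _⊆ᴸ_; _⊈_ to _⊈ᴸ_)

  JoinRepresentation : Carrier → List Carrier → Set
  JoinRepresentation x J = All (_≼ x) J × (∀ z → All (_≼ z) J → x ≼ z)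

  IrredundantJoinRepresentation : Carrier → List Carrier → Set
  IrredundantJoinRepresentation x J =
    JoinRepresentation x J ×
    (∀ J′ → J′ ⊆ᴸ J → J ⊈ᴸ J′ → ¬ JoinRepresentation x J′)

  _Refines_ : Rel (List Carrier) 0ℓ
  J Refines J′ = All (λ y → Any (y ≼_) J′) J

  -- The least element among the irredundant representations of x.
  CanonicalJoinRepresentation : Carrier → List Carrier → Set
  CanonicalJoinRepresentation x J =
    IrredundantJoinRepresentation x J ×
    (∀ J′ → IrredundantJoinRepresentation x J′ → J Refines J′)

  -- x is not the join of a set of other elements; the empty set rules
  -- out the bottom element.
  JoinIrreducible : Carrier → Set
  JoinIrreducible x = ∀ J → JoinRepresentation x J → x ∈ᴸ J

  canonicalJoinComplex : Complex
  canonicalJoinComplex = record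
    { Vertices = On.setoid {B = ∃ JoinIrreducible} P.Eq.setoid proj₁
    ; IsFace   = λ S → ∃ λ x → CanonicalJoinRepresentation x (map proj₁ S)
    }

canonicalMeetComplex : Poset 0ℓ 0ℓ 0ℓ → Complex
canonicalMeetComplex P = canonicalJoinComplex (Flip.poset P)

------------------------------------------------------------------------
-- Ropes

module _ (D : DAG) where
  open DAG D

  record Rope : Set where
    field
      u v       : V
      ∇ Δ       : Subset n
      arc       : u ⟶ v
      disjoint  : Empty (∇ ∩ Δ)
      partition : ∀ w →
        w ∈ ∇ ∪ Δ ⇔ (TransitiveSupport _⟶_ u v w × w ≢ u × w ≢ v)

    ends : Subset n
    ends = ⁅ u ⁆ ∪ ⁅ v ⁆

    quadruple : V × V × Subset n × Subset n
    quadruple = u , v , ∇ , Δ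

  ropeSetoid : Setoid 0ℓ 0ℓ
  ropeSetoid = On.setoid (setoid _) Rope.quadruple

  Crossing : Rel Rope 0ℓ
  Crossing r r′ = ∃₂ λ w w′ → w ≢ w′ ×
    w  ∈ (r.∇ ∪ r.ends) ∩ (r′.Δ ∪ r′.ends) ×
    w′ ∈ (r.Δ ∪ r.ends) ∩ (r′.∇ ∪ r′.ends)
    where
    module r  = Rope r
    module r′ = Rope r′

  open Setoid ropeSetoid using (_≉_)
  open Data.List.Membership.Setoid ropeSetoid
    using () renaming (_∈_ to _∈ᴸ_)

  NonCrossing : List Rope → Set
  NonCrossing S =
    ∀ r r′ → r ∈ᴸ S → r′ ∈ᴸ S → r ≉ r′ → ¬ Crossing r r′

  ropeComplex : Complex
  ropeComplex = record { Vertices = ropeSetoid ; IsFace = NonCrossing }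

  ropeComplex-isSimplicial : IsSimplicial ropeComplex
  ropeComplex-isSimplicial S⊆T noncrossing r r′ r∈S r′∈S =
    noncrossing r r′ (S⊆T {r} r∈S) (S⊆T {r′} r′∈S)

{-# OPTIONS --safe #-}
module Submission where

-- In a skeletal D the transitive support of an arc is a clique, and a
-- reorientation is acyclic as soon as it has no cyclic triangle. So the
-- acyclic reorientations are the sets of arcs which are closed and
-- coclosed on triangles, and joins are transitive closures.
--
-- A rope r = (u , v , ∇ , Δ) gives a join irreducible ji r, reversing the
-- arcs from Δ ∪ {u , v} to ∇ ∪ {u , v}. Exchanging ∇ and Δ gives the
-- complement of a meet irreducible. Both sets of arcs contain (u , v) and
-- nothing else in common, and two ropes cross if and only if the first
-- set of one meets the second set of the other.
--
-- Call (u , v) a descent of x if x reverses it and remains acyclic when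
-- it is put back. The elements y ≤ x reversing a descent (u , v) of x have
-- a least element, which is ji r for a unique rope r. Hence the canonical
-- join representation of x consists of the ji r for the descents of x.
-- Conversely, for a non-crossing set of ropes, the descents of the join
-- of all ji r are exactly the arcs of these ropes.
--
-- Complementation exchanges joins and meets.

open import Defs
import Data.Bool.Properties as Bool
open import Data.Empty using (⊥; ⊥-elim)
open import Data.Fin.Base using (Fin)
open import Data.Fin.Induction using (spo-wellFounded; spo-noetherian)
open import Data.Fin.Properties using (any?; all?; _≟_)
open import Data.Fin.Subset using (Subset; _∈_; _⊆_; _∪_; ⁅_⁆)
open import Data.Fin.Subset.Properties
  using (_∈?_; x∈p∪q⁻; x∈p∪q⁺; x∈p∩q⁺; x∈p∩q⁻; x∈⁅x⁆; x∈⁅y⁆⇒x≡y; ∩-comm; ∪-comm; ⊆-antisym)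
open import Data.List.Base
  using (List; []; _∷_; _∷ʳ_; length; map; allFin; cartesianProduct; concatMap)
import Data.List.Membership.DecPropositional
open import Data.List.Membership.Propositional using (lose; find) renaming (_∈_ to _∈ˡ_)
open import Data.List.Membership.Propositional.Properties
  using (∈-map⁺; ∈-allFin; ∈-cartesianProduct⁺)
import Data.List.Membership.Setoid
open import Data.List.Properties using (map-++; map-∘; length-map)
import Data.List.Relation.Binary.Subset.Setoid
open import Data.List.Relation.Unary.All as All using (All; []; _∷_)
import Data.List.Relation.Unary.All.Properties as All
open import Data.List.Relation.Unary.AllPairs using ([]; _∷_)
open import Data.List.Relation.Unary.Any as Any using (Any; here; there)
import Data.List.Relation.Unary.Any.Properties as Any
open import Data.List.Relation.Unary.Linked as Linked using (Linked; []; [-]; _∷_)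
import Data.List.Relation.Unary.Linked.Properties as Linked
open import Data.List.Relation.Unary.Unique.Propositional using (Unique)
import Data.List.Relation.Unary.Unique.Propositional.Properties as Unique
open import Data.Nat.Base using (ℕ; suc; _≤_; _<_; z≤n; s≤s; s≤s⁻¹; _+_)
open import Data.Nat.Properties
  using (≤-refl; ≤-trans; ≤-reflexive; m≤m+n; m<n⇒m<1+n; +-comm; +-assoc; +-suc;
         +-mono-≤; +-monoʳ-≤)
open import Data.Product.Base using (∃; ∃₂; _×_; _,_; proj₁; proj₂)
open import Data.Sum.Base as Sum using (_⊎_; inj₁; inj₂; [_,_]′)
open import Data.Vec.Base using (tabulate)
open import Data.Vec.Properties using (≡-dec; lookup⇒[]=; []=⇒lookup; lookup∘tabulate)
open import Function.Base using (_∘_; id; flip)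
open import Function.Bundles using (Inverse; _⇔_; mk⇔; Equivalence)
import Function.Construct.Composition as Composition
open import Induction.WellFounded using (Acc; acc)
open import Level using (0ℓ)
open import Relation.Binary.Bundles using (Poset; Setoid)
open import Relation.Binary.Construct.Closure.ReflexiveTransitive
  using (ε; _◅_; _◅◅_; gmap)
open import Relation.Binary.Construct.Closure.Symmetric as Sym using (SymClosure; fwd; bwd)
open import Relation.Binary.Construct.Closure.Transitive using (TransClosure; [_]; _∷_; _++_)
import Relation.Binary.Construct.Flip.EqAndOrd as Flip
open import Relation.Binary.Core using (Rel)
import Relation.Binary.Definitions as B
open import Relation.Binary.PropositionalEquality.Core
  using (_≡_; _≢_; refl; sym; trans; cong; cong₂; subst)
open import Relation.Binary.PropositionalEquality.Properties using (isEquivalence)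
open import Relation.Binary.Structures using (IsStrictPartialOrder)
open import Relation.Nullary.Decidable
  using (Dec; yes; no; does; dec-true; map′; _⊎-dec_; _×-dec_; ¬?; decidable-stable)
open import Relation.Nullary.Negation using (¬_; contradiction)
open import Relation.Unary using (Pred; Decidable)

-- Finite sets and walks

module _ {n} {P : Pred (Fin n) 0ℓ} (P? : Decidable P) where

  select : Subset n
  select = tabulate (does ∘ P?)

  ∈-select⁺ : ∀ {i} → P i → i ∈ select
  ∈-select⁺ {i} p =
    lookup⇒[]= i _ (trans (lookup∘tabulate _ i) (dec-true (P? i) p))

  ∈-select⁻ : ∀ {i} → i ∈ select → P i
  ∈-select⁻ {i} i∈
    with P? i | trans (sym (lookup∘tabulate (does ∘ P?) i)) ([]=⇒lookup i∈)
  ... | yes p | _ = p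

Linked-∈ : ∀ {A : Set} {R : Rel A 0ℓ} {xs ys} → All (_∈ˡ ys) xs → Linked R xs →
  Linked (λ a b → a ∈ˡ ys × b ∈ˡ ys × R a b) xs
Linked-∈ _                []       = []
Linked-∈ _                [-]      = [-]
Linked-∈ (px ∷ py ∷ pxs) (r ∷ rs) = (px , py , r) ∷ Linked-∈ (py ∷ pxs) rs

map-proj₁-toList : ∀ {A : Set} {P : A → Set} {xs} (pxs : All P xs) →
  map proj₁ (All.toList pxs) ≡ xs
map-proj₁-toList []         = refl
map-proj₁-toList (px ∷ pxs) = cong (_ ∷_) (map-proj₁-toList pxs)

module _ {V : Set} {_⟶_ : Rel V 0ℓ} where

  first∈ : ∀ {u v} (π : Path _⟶_ u v) → u ∈ˡ vertices _⟶_ π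
  first∈ ε       = here refl
  first∈ (_ ◅ _) = here refl

  last∈ : ∀ {u v} (π : Path _⟶_ u v) → v ∈ˡ vertices _⟶_ π
  last∈ ε       = here refl
  last∈ (_ ◅ π) = there (last∈ π)

  pathLength-◅◅ : ∀ {u v w} (ρ : Path _⟶_ u v) (σ : Path _⟶_ v w) →
    pathLength _⟶_ (ρ ◅◅ σ) ≡ pathLength _⟶_ ρ + pathLength _⟶_ σ
  pathLength-◅◅ ε       σ = refl
  pathLength-◅◅ (_ ◅ ρ) σ = cong suc (pathLength-◅◅ ρ σ)

  ∈-◅◅ˡ : ∀ {u v w x} (ρ : Path _⟶_ u v) (σ : Path _⟶_ v w) →
    x ∈ˡ vertices _⟶_ ρ → x ∈ˡ vertices _⟶_ (ρ ◅◅ σ)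
  ∈-◅◅ˡ ε       σ (here refl) = first∈ σ
  ∈-◅◅ˡ (_ ◅ ρ) σ (here refl) = here refl
  ∈-◅◅ˡ (_ ◅ ρ) σ (there x∈)  = there (∈-◅◅ˡ ρ σ x∈)

  ∈-◅◅ʳ : ∀ {u v w x} (ρ : Path _⟶_ u v) (σ : Path _⟶_ v w) →
    x ∈ˡ vertices _⟶_ σ → x ∈ˡ vertices _⟶_ (ρ ◅◅ σ)
  ∈-◅◅ʳ ε       σ x∈ = x∈
  ∈-◅◅ʳ (_ ◅ ρ) σ x∈ = there (∈-◅◅ʳ ρ σ x∈)

  record Split {u v} (π : Path _⟶_ u v) (w : V) : Set where
    field
      before  : Path _⟶_ u w
      after   : Path _⟶_ w v
      lengths : pathLength _⟶_ before + pathLength _⟶_ after ≡ pathLength _⟶_ π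
      covers  : ∀ {x} → x ∈ˡ vertices _⟶_ π →
                x ∈ˡ vertices _⟶_ before ⊎ x ∈ˡ vertices _⟶_ after

  split : ∀ {u v w} (π : Path _⟶_ u v) → w ∈ˡ vertices _⟶_ π → Split π w
  split ε (here refl) = record
    { before = ε ; after = ε ; lengths = refl ; covers = inj₁ }
  split (e ◅ π) (here refl) = record
    { before = ε ; after = e ◅ π ; lengths = refl ; covers = inj₂ }
  split (e ◅ π) (there w∈) = record
    { before  = e ◅ before
    ; after   = after
    ; lengths = cong suc lengths
    ; covers  = λ { (here refl) → inj₁ (here refl)
                  ; (there x∈)  → Sum.map₁ there (covers x∈) }
    }
    where open Split (split π w∈)

  length-vertices : ∀ {u v} (π : Path _⟶_ u v) →
    length (vertices _⟶_ π) ≡ suc (pathLength _⟶_ π)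
  length-vertices ε       = refl
  length-vertices (_ ◅ π) = cong suc (length-vertices π)

  linked-vertices : ∀ {u v z} (π : Path _⟶_ u v) → v ⟶ z →
    Linked _⟶_ (vertices _⟶_ π ∷ʳ z)
  linked-vertices ε             d = d ∷ [-]
  linked-vertices (e ◅ ε)       d = e ∷ d ∷ [-]
  linked-vertices (e ◅ e′ ◅ π) d = e ∷ linked-vertices (e′ ◅ π) d

  plus : ∀ {u v w} → Path _⟶_ u v → v ⟶ w → TransClosure _⟶_ u w
  plus ε       e = [ e ]
  plus (d ◅ π) e = d ∷ plus π e

  uncons⁺ : ∀ {u w} → TransClosure _⟶_ u w → ∃ λ v → u ⟶ v × Path _⟶_ v w
  uncons⁺ [ e ]   = _ , e , ε
  uncons⁺ (e ∷ t) with uncons⁺ t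
  ... | _ , e′ , π = _ , e , e′ ◅ π

-- Skeletal graphs

module Skeleton (D : DAG) (skeletal : Skeletal D) where
  open DAG D

  vertebrate : Vertebrate _⟶_
  vertebrate = proj₁ skeletal

  filled : Filled _⟶_
  filled = proj₂ skeletal

  Adj : Rel V 0ℓ
  Adj = Adjacent _⟶_

  arc? : ∀ u v → Dec (u ⟶ v)
  arc? u v = v ∈? arcs u

  adj? : ∀ u v → Dec (Adj u v)
  adj? u v = map′ [ fwd , bwd ]′ (λ { (fwd e) → inj₁ e ; (bwd e) → inj₂ e })
    (arc? u v ⊎-dec arc? v u)

  open Data.List.Membership.DecPropositional (_≟_ {n})
    using () renaming (_∈?_ to _∈ˡ?_)

  no-return : ∀ {u v} → Path _⟶_ u v → ¬ v ⟶ u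
  no-return π e = acyclic _ (plus π e)

  no-loop : ∀ {u} → ¬ u ⟶ u
  no-loop = no-return ε

  no-2-cycle : ∀ {u v} → u ⟶ v → ¬ v ⟶ u
  no-2-cycle e = no-return (e ◅ ε)

  no-3-cycle : ∀ {u v w} → u ⟶ v → v ⟶ w → ¬ w ⟶ u
  no-3-cycle e d = no-return (e ◅ d ◅ ε)

  ⟶⇒≢ : ∀ {u v} → u ⟶ v → u ≢ v
  ⟶⇒≢ e refl = no-loop e

  Adj⇒≢ : ∀ {u v} → Adj u v → u ≢ v
  Adj⇒≢ (fwd e) = ⟶⇒≢ e
  Adj⇒≢ (bwd e) = ⟶⇒≢ e ∘ sym

  support⇒between : ∀ {u v w} → u ⟶ v → TransitiveSupport _⟶_ u v w →
    w ≢ u → w ≢ v → u ⟶ w × w ⟶ v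
  support⇒between e (π , w∈) w≢u w≢v = from-left , to-right
    where
    open Split (split π w∈)
    from-left = case-adj (filled π (fwd e) (first∈ π) w∈ (w≢u ∘ sym))
      where
      case-adj : Adj _ _ → _
      case-adj (fwd d) = d
      case-adj (bwd d) = ⊥-elim (no-return before d)
    to-right = case-adj (filled π (fwd e) w∈ (last∈ π) w≢v)
      where
      case-adj : Adj _ _ → _
      case-adj (fwd d) = d
      case-adj (bwd d) = ⊥-elim (no-return after d)

  fill : ∀ {u v w} → u ⟶ w → TransClosure _⟶_ w v → u ⟶ v → w ⟶ v
  fill e t d with uncons⁺ t
  ... | _ , e′ , π = proj₂ (support⇒between d (e ◅ e′ ◅ π , there (here refl))
    (⟶⇒≢ e ∘ sym) λ { refl → no-return π e′ })

  Cover : List V → Rel V 0ℓ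
  Cover L u v = u ⟶ v × (∀ {w} → w ∈ˡ L → u ⟶ w → ¬ w ⟶ v)

  no-cover-cycle : ∀ x xs → let L = x ∷ xs in Unique L → 3 ≤ length L →
    ¬ Linked (SymClosure (Cover L)) (L ∷ʳ x)
  no-cover-cycle x xs unique long linked =
    vertebrate S (X , XS , Unique.map⁻ (subst Unique (sym L≡) unique) ,
      subst (3 ≤_) (sym |L|≡) long ,
      Linked.map lift-cover (Linked.map⁻ (subst (Linked _) (sym L∷ʳ≡) linked)))
    where
    L = x ∷ xs
    S = select (_∈ˡ? L)
    X : ∃ (_∈ S)
    X = x , ∈-select⁺ (_∈ˡ? L) (here refl)
    pxs : All (_∈ S) xs
    pxs = All.tabulate (∈-select⁺ (_∈ˡ? L) ∘ there)
    XS = All.toList pxs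
    L≡ : map proj₁ (X ∷ XS) ≡ L
    L≡ = cong (x ∷_) (map-proj₁-toList pxs)
    |L|≡ : length (X ∷ XS) ≡ length L
    |L|≡ = trans (sym (length-map proj₁ (X ∷ XS))) (cong length L≡)
    L∷ʳ≡ : map proj₁ ((X ∷ XS) ∷ʳ X) ≡ L ∷ʳ x
    L∷ʳ≡ = trans (map-++ proj₁ (X ∷ XS) (X ∷ [])) (cong (_∷ʳ x) L≡)
    cover⇒reduced : ∀ {U W} → Cover L (proj₁ U) (proj₁ W) →
      TransitiveReduction (induced _⟶_ S) U W
    cover⇒reduced (e , minimal) = e , λ
      { (ε , ())
      ; (_ ◅ ε , s≤s ())
      ; (_◅_ {j = C} d (d′ ◅ π) , _) → minimal (∈-select⁻ (_∈ˡ? L) (proj₂ C)) d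
          (fill d (prepend d′ (gmap {U = _⟶_} proj₁ id π)) e)
      }
      where
      prepend : ∀ {a b c} → a ⟶ b → Path _⟶_ b c → TransClosure _⟶_ a c
      prepend d ε        = [ d ]
      prepend d (d′ ◅ π) = d ∷ prepend d′ π
    lift-cover : ∀ {U W} → SymClosure (Cover L) (proj₁ U) (proj₁ W) →
      SymClosure (TransitiveReduction (induced _⟶_ S)) U W
    lift-cover (fwd c) = fwd (cover⇒reduced c)
    lift-cover (bwd c) = bwd (cover⇒reduced c)

  -- Otherwise u , w , v , w′ is a cycle in the transitive reduction of
  -- the subgraph it induces.
  between-total : ∀ {u v w w′} → u ⟶ w → w ⟶ v → u ⟶ w′ → w′ ⟶ v →
    w ≢ w′ → Adj w w′
  between-total {u} {v} {w} {w′} uw wv uw′ w′v w≢w′ with adj? w w′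
  ... | yes adj = adj
  ... | no ¬adj = ⊥-elim (no-cover-cycle u (w ∷ v ∷ w′ ∷ [])
    ((⟶⇒≢ uw ∷ u≢v ∷ ⟶⇒≢ uw′ ∷ []) ∷ (⟶⇒≢ wv ∷ w≢w′ ∷ []) ∷
     ((⟶⇒≢ w′v ∘ sym) ∷ []) ∷ [] ∷ [])
    (s≤s (s≤s (s≤s z≤n)))
    (fwd (uw , λ
       { (here refl)                         c _ → no-loop c
       ; (there (here refl))                 _ c → no-loop c
       ; (there (there (here refl)))         _ c → no-2-cycle wv c
       ; (there (there (there (here refl)))) _ c → ¬adj (bwd c) }) ∷
     fwd (wv , λ
       { (here refl)                         c _ → no-2-cycle uw c
       ; (there (here refl))                 c _ → no-loop c
       ; (there (there (here refl)))         _ c → no-loop c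
       ; (there (there (there (here refl)))) c _ → ¬adj (fwd c) }) ∷
     bwd (w′v , λ
       { (here refl)                         c _ → no-2-cycle uw′ c
       ; (there (here refl))                 c _ → ¬adj (bwd c)
       ; (there (there (here refl)))         _ c → no-loop c
       ; (there (there (there (here refl)))) c _ → no-loop c }) ∷
     bwd (uw′ , λ
       { (here refl)                         c _ → no-loop c
       ; (there (here refl))                 _ c → ¬adj (fwd c)
       ; (there (there (here refl)))         _ c → no-2-cycle w′v c
       ; (there (there (there (here refl)))) _ c → no-loop c }) ∷ [-]))
    where
    u≢v : u ≢ v
    u≢v refl = no-2-cycle uw wv

  Triangle : List V → V → V → V → Set
  Triangle L p q r = (p ∈ˡ L × q ∈ˡ L × r ∈ˡ L) × (Adj p q × Adj q r × Adj r p)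

  triangle? : ∀ L → Dec (∃ λ p → ∃₂ (Triangle L p))
  triangle? L = any? λ p → any? λ q → any? λ r →
    (p ∈ˡ? L ×-dec q ∈ˡ? L ×-dec r ∈ˡ? L) ×-dec (adj? p q ×-dec adj? q r ×-dec adj? r p)

  -- In a set of vertices without triangles, every arc survives in the
  -- transitive reduction.
  cycle-triangle : ∀ x xs → let L = x ∷ xs in Unique L → 3 ≤ length L →
    Linked Adj (L ∷ʳ x) → ∃ λ p → ∃₂ (Triangle L p)
  cycle-triangle x xs unique long linked with triangle? (x ∷ xs)
  ... | yes t = t
  ... | no ¬t = ⊥-elim (no-cover-cycle x xs unique long
    (Linked.map cover (Linked-∈ (All.++⁺ (All.tabulate id) (here refl ∷ [])) linked)))
    where
    L = x ∷ xs
    cover : ∀ {a b} → a ∈ˡ L × b ∈ˡ L × Adj a b → SymClosure (Cover L) a b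
    cover (a∈ , b∈ , fwd e) = fwd (e , λ c∈ d d′ →
      ¬t (_ , _ , _ , (a∈ , c∈ , b∈) , (fwd d , fwd d′ , bwd e)))
    cover (a∈ , b∈ , bwd e) = bwd (e , λ c∈ d d′ →
      ¬t (_ , _ , _ , (b∈ , c∈ , a∈) , (fwd d , fwd d′ , bwd e)))

  module _ (_⇀_ : Rel V 0ℓ)
    (sound : ∀ {a b} → a ⇀ b → Adj a b)
    (total : ∀ {a b} → Adj a b → a ⇀ b ⊎ b ⇀ a)
    (asym  : ∀ {a b} → a ⇀ b → ¬ b ⇀ a)
    (no-cyclic-triangle : ∀ {a b c} → a ⇀ b → b ⇀ c → ¬ c ⇀ a)
    where

    private
      len : ∀ {a b} → Path _⇀_ a b → ℕ
      len = pathLength _⇀_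

    repetition : ∀ {a b} (π : Path _⇀_ a b) → Unique (vertices _⇀_ π) ⊎
      ∃₂ λ c d → c ⇀ d × ∃ λ (σ : Path _⇀_ d c) → len σ < len π
    repetition ε = inj₁ ([] ∷ [])
    repetition {a} (e ◅ π) with a ∈ˡ? vertices _⇀_ π
    ... | yes a∈ = inj₂ (_ , _ , e , before , s≤s (subst (len before ≤_) lengths (m≤m+n _ _)))
      where open Split (split π a∈)
    ... | no a∉ with repetition π
    ...   | inj₁ unique               = inj₁ (All.¬Any⇒All¬ _ a∉ ∷ unique)
    ...   | inj₂ (_ , _ , d , σ , lt) = inj₂ (_ , _ , d , σ , m<n⇒m<1+n lt)

    nonempty : ∀ {a b} → a ≢ b → (π : Path _⇀_ a b) → 1 ≤ len π
    nonempty a≢b ε       = contradiction refl a≢b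
    nonempty a≢b (_ ◅ _) = s≤s z≤n

    summand< : ∀ {a b c k} → 1 ≤ b → 1 ≤ c → a + (b + c) ≤ suc k → a < k
    summand< {a} 1≤b 1≤c le = s≤s⁻¹ (≤-trans (≤-reflexive (+-comm 2 a))
      (≤-trans (+-monoʳ-≤ a (+-mono-≤ 1≤b 1≤c)) le))

    rotate : ∀ {k} a b c → a + (b + c) ≤ k → b + (c + a) ≤ k
    rotate a b c = ≤-trans (≤-reflexive
      (trans (sym (+-assoc b c a)) (+-comm (b + c) a)))

    NoClosedWalk : ℕ → Set
    NoClosedWalk k = ∀ {a b} → a ⇀ b → (π : Path _⇀_ b a) → ¬ len π < k

    -- Either the triangle p q r is cyclic or one of its edges
    -- shortcuts the closed walk.
    shortcut : ∀ {k p q r} → NoClosedWalk k → Adj p q → Adj q r → Adj r p →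
      (α : Path _⇀_ p q) (β : Path _⇀_ q r) (γ : Path _⇀_ r p) →
      ¬ len α + (len β + len γ) ≤ suc k
    shortcut {k} no-walk pq qr rp α β γ le with total pq | total qr | total rp
    ... | inj₂ e | _      | _      = no-walk e α
      (summand< (nonempty (Adj⇒≢ qr) β) (nonempty (Adj⇒≢ rp) γ) le)
    ... | inj₁ _ | inj₂ e | _      = no-walk e β
      (summand< (nonempty (Adj⇒≢ rp) γ) (nonempty (Adj⇒≢ pq) α)
        (rotate (len α) (len β) (len γ) le))
    ... | inj₁ _ | inj₁ _ | inj₂ e = no-walk e γ
      (summand< (nonempty (Adj⇒≢ pq) α) (nonempty (Adj⇒≢ qr) β)
        (rotate (len β) (len γ) (len α) (rotate (len α) (len β) (len γ) le)))
    ... | inj₁ e | inj₁ d  | inj₁ c = no-cyclic-triangle e d c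

    unique-walk : ∀ {k a b} → NoClosedWalk k → a ⇀ b → (π : Path _⇀_ b a) →
      len π ≤ k → ¬ Unique (vertices _⇀_ π)
    unique-walk no-walk e ε             le unique = asym e e
    unique-walk no-walk e (d ◅ ε)       le unique = asym e d
    unique-walk {k} {a} {b} no-walk e π@(e₁ ◅ π′@(e₂ ◅ π″)) le unique
      with cycle-triangle _ _ unique
        (subst (3 ≤_) (sym (length-vertices π)) (s≤s (s≤s (s≤s z≤n))))
        (Linked.map sound (linked-vertices π e))
    ... | p , q , r , (p∈ , q∈ , r∈) , (pq , qr , rp) =
      [ (λ r∈before → let module T = Split (split S.before r∈before) in
           shortcut no-walk (Sym.symmetric _ rp) (Sym.symmetric _ qr)
             (Sym.symmetric _ pq) T.before T.after S.after
             (≤-trans (≤-reflexive (trans (sym (+-assoc (len T.before) _ _))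
               (cong (_+ len S.after) T.lengths))) total≤))
      , (λ r∈after → let module T = Split (split S.after r∈after) in
           shortcut no-walk pq qr rp S.before T.before T.after
             (≤-trans (≤-reflexive (cong (len S.before +_) T.lengths)) total≤))
      ]′ (S.covers (in-walk r∈))
      where
      module P = Split (split π p∈)
      walk : Path _⇀_ p p
      walk = P.after ◅◅ (e ◅ P.before)
      in-walk : ∀ {x} → x ∈ˡ vertices _⇀_ π → x ∈ˡ vertices _⇀_ walk
      in-walk x∈ = [ ∈-◅◅ʳ P.after (e ◅ P.before) ∘ there , ∈-◅◅ˡ P.after (e ◅ P.before) ]′
        (P.covers x∈)
      module S = Split (split walk (in-walk q∈))
      total≤ : len S.before + len S.after ≤ suc k
      total≤ = ≤-trans (≤-reflexive (trans S.lengths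
        (trans (pathLength-◅◅ P.after (e ◅ P.before))
          (trans (+-suc _ _) (cong suc (trans (+-comm (len P.after) _) P.lengths))))))
        (s≤s le)

    no-closed-walk : ∀ k → NoClosedWalk k
    no-closed-walk (suc k) e π (s≤s le) with repetition π
    ... | inj₁ unique                = unique-walk (no-closed-walk k) e π le unique
    ... | inj₂ (_ , _ , d , σ , lt) = no-closed-walk k d σ (≤-trans lt le)

    triangles⇒acyclic : Acyclic _⇀_
    triangles⇒acyclic v t with uncons⁺ t
    ... | _ , e , π = no-closed-walk _ e π ≤-refl

-- The lattice of acyclic reorientations

acyclic⇒spo : ∀ {n} {_⟶_ : Rel (Fin n) 0ℓ} → Acyclic _⟶_ →
  IsStrictPartialOrder _≡_ (TransClosure _⟶_)
acyclic⇒spo acyclic = record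
  { isEquivalence = isEquivalence
  ; irrefl        = λ { refl → acyclic _ }
  ; trans         = _++_
  ; <-resp-≈      = (λ { refl → id }) , λ { refl → id }
  }

module Lattice (D : DAG) (skeletal : Skeletal D) where
  open DAG D
  open Skeleton D skeletal
  open AcyclicReorientation
  open Poset (AR D) using (_≈_) renaming (Carrier to AO; _≤_ to _≼_)

  Rev Dir : AO → Rel V 0ℓ
  Rev x = Arc (reversed x)
  Dir x = Reorient D (reversed x)

  rev? : ∀ x a b → Dec (Rev x a b)
  rev? x a b = b ∈? reversed x a

  dir? : ∀ x a b → Dec (Dir x a b)
  dir? x a b = (arc? a b ×-dec ¬? (rev? x a b)) ⊎-dec (arc? b a ×-dec rev? x b a)

  rev⇒arc : ∀ x {a b} → Rev x a b → a ⟶ b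
  rev⇒arc x = reversed⊆ x _

  rev⇒dir : ∀ x {a b} → Rev x a b → Dir x b a
  rev⇒dir x p = inj₂ (rev⇒arc x p , p)

  dir⇒adj : ∀ x {a b} → Dir x a b → Adj a b
  dir⇒adj x (inj₁ (e , _)) = fwd e
  dir⇒adj x (inj₂ (e , _)) = bwd e

  dir-total : ∀ x {a b} → Adj a b → Dir x a b ⊎ Dir x b a
  dir-total x {a} {b} (fwd e) with rev? x a b
  ... | yes p = inj₂ (inj₂ (e , p))
  ... | no ¬p = inj₁ (inj₁ (e , ¬p))
  dir-total x {a} {b} (bwd e) with rev? x b a
  ... | yes p = inj₁ (inj₂ (e , p))
  ... | no ¬p = inj₂ (inj₁ (e , ¬p))

  dir-no-3-cycle : ∀ x {a b c} → Dir x a b → Dir x b c → ¬ Dir x c a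
  dir-no-3-cycle x p q r = reoriented x _ (p ∷ q ∷ [ r ])

  closed : ∀ x {a b c} → a ⟶ c → Rev x a b → Rev x b c → Rev x a c
  closed x {a} {b} {c} e p q with rev? x a c
  ... | yes r = r
  ... | no ¬r = ⊥-elim (dir-no-3-cycle x (rev⇒dir x q) (rev⇒dir x p) (inj₁ (e , ¬r)))

  coclosed : ∀ x {a b c} → a ⟶ b → b ⟶ c → Rev x a c → Rev x a b ⊎ Rev x b c
  coclosed x {a} {b} {c} e d r with rev? x a b | rev? x b c
  ... | yes p | _     = inj₁ p
  ... | no _  | yes q = inj₂ q
  ... | no ¬p | no ¬q =
    ⊥-elim (dir-no-3-cycle x (inj₁ (e , ¬p)) (inj₁ (d , ¬q)) (rev⇒dir x r))

  record Biclosed (X : Rel V 0ℓ) : Set where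
    field
      X?         : B.Decidable X
      X⇒⟶        : ∀ {a b} → X a b → a ⟶ b
      X-closed   : ∀ {a b c} → a ⟶ c → X a b → X b c → X a c
      X-coclosed : ∀ {a b c} → a ⟶ b → b ⟶ c → X a c → X a b ⊎ X b c

  module _ {X : Rel V 0ℓ} (X-biclosed : Biclosed X) where
    open Biclosed X-biclosed

    private
      R : ArcSet n
      R a = select (X? a)

      R⁻ : ∀ {a b} → Arc R a b → X a b
      R⁻ = ∈-select⁻ (X? _)

      R⁺ : ∀ {a b} → X a b → Arc R a b
      R⁺ = ∈-select⁺ (X? _)

    abstract
      fromBiclosed : AO
      fromBiclosed = record
        { reversed   = R
        ; reversed⊆  = λ _ → X⇒⟶ ∘ R⁻
        ; reoriented = triangles⇒acyclic (Reorient D R) sound total asym triangle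
        }
        where
        sound : ∀ {a b} → Reorient D R a b → Adj a b
        sound (inj₁ (e , _)) = fwd e
        sound (inj₂ (e , _)) = bwd e
        total : ∀ {a b} → Adj a b → Reorient D R a b ⊎ Reorient D R b a
        total {a} {b} (fwd e) with b ∈? R a
        ... | yes p = inj₂ (inj₂ (e , p))
        ... | no ¬p = inj₁ (inj₁ (e , ¬p))
        total {a} {b} (bwd e) with a ∈? R b
        ... | yes p = inj₁ (inj₂ (e , p))
        ... | no ¬p = inj₂ (inj₁ (e , ¬p))
        asym : ∀ {a b} → Reorient D R a b → ¬ Reorient D R b a
        asym (inj₁ (e , _))  (inj₁ (d , _))  = no-2-cycle e d
        asym (inj₁ (_ , ¬p)) (inj₂ (_ , p))  = ¬p p
        asym (inj₂ (_ , p))  (inj₁ (_ , ¬p)) = ¬p p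
        asym (inj₂ (e , _))  (inj₂ (d , _))  = no-2-cycle e d
        no-coclosed : ∀ {a b c} → a ⟶ b → b ⟶ c →
          ¬ Arc R a b → ¬ Arc R b c → ¬ Arc R a c
        no-coclosed e d ¬p ¬q r = [ ¬p ∘ R⁺ , ¬q ∘ R⁺ ]′ (X-coclosed e d (R⁻ r))
        no-closed : ∀ {a b c} → a ⟶ c → Arc R a b → Arc R b c → ¬ ¬ Arc R a c
        no-closed e p q ¬r = ¬r (R⁺ (X-closed e (R⁻ p) (R⁻ q)))
        triangle : ∀ {a b c} → Reorient D R a b → Reorient D R b c → ¬ Reorient D R c a
        triangle (inj₁ (e , _)) (inj₁ (d , _)) (inj₁ (c , _)) = no-3-cycle e d c
        triangle (inj₁ (e , p)) (inj₁ (d , q)) (inj₂ (_ , r)) = no-coclosed e d p q r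
        triangle (inj₁ (e , p)) (inj₂ (_ , q)) (inj₁ (c , r)) = no-coclosed c e r p q
        triangle (inj₂ (_ , p)) (inj₁ (d , q)) (inj₁ (c , r)) = no-coclosed d c q r p
        triangle (inj₁ (e , p)) (inj₂ (_ , q)) (inj₂ (_ , r)) = no-closed e r q p
        triangle (inj₂ (_ , p)) (inj₁ (d , q)) (inj₂ (_ , r)) = no-closed d p r q
        triangle (inj₂ (_ , p)) (inj₂ (_ , q)) (inj₁ (c , r)) = no-closed c q p r
        triangle (inj₂ (e , _)) (inj₂ (d , _)) (inj₂ (c , _)) = no-3-cycle c d e

      rev⁺ : ∀ {a b} → X a b → Rev fromBiclosed a b
      rev⁺ = R⁺

      rev⁻ : ∀ {a b} → Rev fromBiclosed a b → X a b
      rev⁻ = R⁻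

  module _ (Js : List AO) where

    Some : Rel V 0ℓ
    Some a b = Any (λ y → Rev y a b) Js

    some⇒arc : ∀ {a b} → Some a b → a ⟶ b
    some⇒arc s with Any.satisfied s
    ... | y , p = rev⇒arc y p

    reach? : ∀ {a} → Acc (flip (TransClosure _⟶_)) a → ∀ b → Dec (TransClosure Some a b)
    reach? {a} (acc rec) b = map′
      [ [_] , (λ (_ , s , t) → s ∷ t) ]′
      (λ { [ s ] → inj₁ s ; (s ∷ t) → inj₂ (_ , s , t) })
      (some? b ⊎-dec any? step?)
      where
      some? : ∀ c → Dec (Some a c)
      some? c = Any.any? (λ y → rev? y a c) Js
      step? : ∀ c → Dec (Some a c × TransClosure Some c b)
      step? c with some? c
      ... | no ¬s = no (¬s ∘ proj₁)
      ... | yes s = map′ (s ,_) proj₂ (reach? (rec [ some⇒arc s ]) b)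

    reach⇒path : ∀ {a b} → TransClosure Some a b → TransClosure _⟶_ a b
    reach⇒path [ s ]   = [ some⇒arc s ]
    reach⇒path (s ∷ t) = some⇒arc s ∷ reach⇒path t

    Reach : Rel V 0ℓ
    Reach a b = a ⟶ b × TransClosure Some a b

    some-coclosed : ∀ {a b c} → a ⟶ b → b ⟶ c → Some a c → Some a b ⊎ Some b c
    some-coclosed e d s with find s
    ... | y , y∈ , p = Sum.map (lose y∈) (lose y∈) (coclosed y e d p)

    reach-coclosed : ∀ {a b c} → a ⟶ b → b ⟶ c → a ⟶ c → TransClosure Some a c →
      TransClosure Some a b ⊎ TransClosure Some b c
    reach-coclosed e d f [ s ] = Sum.map [_] [_] (some-coclosed e d s)
    reach-coclosed {b = b} e d f (_∷_ {y = m} s t) with m ≟ b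
    ... | yes refl = inj₁ [ s ]
    ... | no m≢b with fill (some⇒arc s) (reach⇒path t) f
    ...   | mc with between-total (some⇒arc s) mc e d m≢b
    ...     | fwd mb = Sum.map₁ (s ∷_) (reach-coclosed mb d mc t)
    ...     | bwd bm = Sum.map [_] (_∷ t) (some-coclosed e bm s)

    reach-biclosed : Biclosed Reach
    reach-biclosed = record
      { X?         = λ a b → arc? a b ×-dec
          reach? (spo-noetherian (acyclic⇒spo acyclic) a) b
      ; X⇒⟶        = proj₁
      ; X-closed   = λ { e (_ , s) (_ , t) → e , s ++ t }
      ; X-coclosed = λ { e d (f , t) →
          Sum.map (e ,_) (d ,_) (reach-coclosed e d f t) }
      }

    lub : AO
    lub = fromBiclosed reach-biclosed

    reach-least : ∀ z → All (_≼ z) Js → ∀ {a b} → a ⟶ b → TransClosure Some a b → Rev z a b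
    reach-least z ≤z e [ s ] with find s
    ... | y , y∈ , p = All.lookup ≤z y∈ _ p
    reach-least z ≤z e (s ∷ t) =
      closed z e (reach-least z ≤z (some⇒arc s) [ s ])
        (reach-least z ≤z (fill (some⇒arc s) (reach⇒path t) e) t)

    lub-join : JoinRepresentation (AR D) lub Js
    lub-join =
      All.tabulate (λ {y} y∈ _ p → rev⁺ reach-biclosed (rev⇒arc y p , [ lose y∈ p ])) ,
      λ z ≤z _ p → let e , t = rev⁻ reach-biclosed p in reach-least z ≤z e t

  reverse-biclosed : ∀ x → Biclosed (λ a b → a ⟶ b × ¬ Rev x a b)
  reverse-biclosed x = record
    { X?         = λ a b → arc? a b ×-dec ¬? (rev? x a b)
    ; X⇒⟶        = proj₁
    ; X-closed   = λ { e (d , ¬p) (c , ¬q) → e , [ ¬p , ¬q ]′ ∘ coclosed x d c }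
    ; X-coclosed = split-arc
    }
    where
    split-arc : ∀ {a b c} → a ⟶ b → b ⟶ c → a ⟶ c × ¬ Rev x a c →
      (a ⟶ b × ¬ Rev x a b) ⊎ (b ⟶ c × ¬ Rev x b c)
    split-arc {a} {b} e d (f , ¬r) with rev? x a b
    ... | no ¬p = inj₁ (e , ¬p)
    ... | yes p = inj₂ (d , ¬r ∘ closed x f p)

  reverse : AO → AO
  reverse x = fromBiclosed (reverse-biclosed x)

  reverse⁺ : ∀ x {a b} → a ⟶ b → ¬ Rev x a b → Rev (reverse x) a b
  reverse⁺ x e ¬p = rev⁺ (reverse-biclosed x) (e , ¬p)

  reverse⁻ : ∀ x {a b} → Rev (reverse x) a b → ¬ Rev x a b
  reverse⁻ x p = proj₂ (rev⁻ (reverse-biclosed x) p)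

  reverse-antitone : ∀ x y → x ≼ y → reverse y ≼ reverse x
  reverse-antitone x y x≤y _ p = reverse⁺ x (rev⇒arc (reverse y) p) (reverse⁻ y p ∘ x≤y _)

  reverse-involutive : ∀ x → reverse (reverse x) ≈ x
  reverse-involutive x = AR.antisym {reverse (reverse x)} {x}
    (λ a {b} p → decidable-stable (rev? x a b) λ ¬p →
      reverse⁻ (reverse x) p (reverse⁺ x (rev⇒arc (reverse (reverse x)) p) ¬p))
    (λ a p → reverse⁺ (reverse x) (rev⇒arc x p) λ q → reverse⁻ x q p)
    where module AR = Poset (AR D)

  glb : AO → AO → AO
  glb x y = reverse (lub (reverse x ∷ reverse y ∷ []))

  glb≤ˡ : ∀ x y → glb x y ≼ x
  glb≤ˡ x y a {b} p = decidable-stable (rev? x a b) λ ¬p →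
    reverse⁻ (lub (reverse x ∷ reverse y ∷ [])) p
      (All.head (proj₁ (lub-join (reverse x ∷ reverse y ∷ []))) a
        (reverse⁺ x (rev⇒arc (glb x y) p) ¬p))

  glb≤ʳ : ∀ x y → glb x y ≼ y
  glb≤ʳ x y a {b} p = decidable-stable (rev? y a b) λ ¬p →
    reverse⁻ (lub (reverse x ∷ reverse y ∷ [])) p
      (All.head (All.tail (proj₁ (lub-join (reverse x ∷ reverse y ∷ [])))) a
        (reverse⁺ y (rev⇒arc (glb x y) p) ¬p))

  glb-greatest : ∀ x y z → z ≼ x → z ≼ y → z ≼ glb x y
  glb-greatest x y z z≤x z≤y a {b} p =
    reverse⁺ (lub Js) (rev⇒arc z p) λ q → reverse⁻ z
      (proj₂ (lub-join Js) (reverse z)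
        (reverse-antitone z x z≤x ∷ reverse-antitone z y z≤y ∷ []) a q) p
    where Js = reverse x ∷ reverse y ∷ []

  Flippable : AO → Rel V 0ℓ
  Flippable x u v = ∀ {w} → Dir x v w → ¬ Dir x w u

  bypass? : ∀ x u v → Dec (∃ λ w → Dir x v w × Dir x w u)
  bypass? x u v = any? λ w → dir? x v w ×-dec dir? x w u

  Descent : AO → Rel V 0ℓ
  Descent x u v = Rev x u v × Flippable x u v

  module _ (x : AO) {u v : V} (descent : Descent x u v) where
    private
      flippable : Flippable x u v
      flippable = proj₂ descent

      X : Rel V 0ℓ
      X a b = Rev x a b × ¬ (a ≡ u × b ≡ v)

    flip-biclosed : Biclosed X
    flip-biclosed = record
      { X?         = λ a b → rev? x a b ×-dec ¬? ((a ≟ u) ×-dec (b ≟ v))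
      ; X⇒⟶        = rev⇒arc x ∘ proj₁
      ; X-closed   = λ { e (p , _) (q , _) → closed x e p q ,
          λ { (refl , refl) → flippable (rev⇒dir x q) (rev⇒dir x p) } }
      ; X-coclosed = λ e d (p , ¬uv) → case-coclosed e d p (coclosed x e d p)
      }
      where
      case-coclosed : ∀ {a b c} → a ⟶ b → b ⟶ c → Rev x a c →
        Rev x a b ⊎ Rev x b c → X a b ⊎ X b c
      case-coclosed {a} {b} {c} e d r (inj₁ p) with (a ≟ u) ×-dec (b ≟ v) | rev? x b c
      ... | no ≢uv            | _     = inj₁ (p , ≢uv)
      ... | yes (refl , refl) | yes q = inj₂ (q , λ { (refl , _) → no-loop e })
      ... | yes (refl , refl) | no ¬q = ⊥-elim (flippable (inj₁ (d , ¬q)) (rev⇒dir x r))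
      case-coclosed {a} {b} {c} e d r (inj₂ q) with (b ≟ u) ×-dec (c ≟ v) | rev? x a b
      ... | no ≢uv            | _     = inj₂ (q , ≢uv)
      ... | yes (refl , refl) | yes p = inj₁ (p , λ { (_ , refl) → no-loop d })
      ... | yes (refl , refl) | no ¬p = ⊥-elim (flippable (rev⇒dir x r) (inj₁ (e , ¬p)))

    flipArc : AO
    flipArc = fromBiclosed flip-biclosed

  module _ (x w : AO) (w≤x : w ≼ x) where
    private
      x-spo : IsStrictPartialOrder _≡_ (TransClosure (Dir x))
      x-spo = acyclic⇒spo (reoriented x)

    -- If x is not a cover relation at (v , u), then w, being acyclic, also
    -- changes the orientation of a shorter arc between v and u.
    find-descent : ∀ {v} → Acc (flip (TransClosure (Dir x))) v →
      ∀ {u} → Acc (TransClosure (Dir x)) u → Dir x v u → Dir w u v →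
      ∃₂ λ a b → Descent x a b × ¬ Rev w a b
    find-descent {v} (acc later) = inner
      where
      inner : ∀ {u} → Acc (TransClosure (Dir x)) u → Dir x v u → Dir w u v →
        ∃₂ λ a b → Descent x a b × ¬ Rev w a b
      inner {u} (acc earlier) vu uv with bypass? x u v
      inner {u} (acc earlier) vu uv | yes (t , vt , tu)
        with dir-total w (dir⇒adj x vt) | dir-total w (dir⇒adj x tu)
      ... | inj₂ tv | _       = inner (earlier [ tu ]) vt tv
      ... | inj₁ _  | inj₂ ut = find-descent (later [ vt ]) (spo-wellFounded x-spo u) tu ut
      ... | inj₁ vt | inj₁ tu = ⊥-elim (dir-no-3-cycle w uv vt tu)
      inner _ (inj₂ (e , p))  (inj₁ (_ , ¬q)) | no ¬t =
        _ , _ , (p , λ vt tu → ¬t (_ , vt , tu)) , ¬q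
      inner _ (inj₁ (e , _))  (inj₁ (d , _))  | no ¬t = ⊥-elim (no-2-cycle e d)
      inner _ (inj₁ (_ , ¬p)) (inj₂ (_ , q))  | no ¬t = ⊥-elim (¬p (w≤x _ q))
      inner _ (inj₂ (e , _))  (inj₂ (d , _))  | no ¬t = ⊥-elim (no-2-cycle e d)

    missing-descent : ∀ {u v} → Rev x u v → ¬ Rev w u v →
      ∃₂ λ a b → Descent x a b × ¬ Rev w a b
    missing-descent p ¬q = find-descent (spo-noetherian x-spo _)
      (spo-wellFounded x-spo _) (rev⇒dir x p) (inj₁ (rev⇒arc x p , ¬q))

  CoversDescents : AO → List AO → Set
  CoversDescents x Js = ∀ {u v} → Descent x u v → Any (λ y → Rev y u v) Js

  join⇒covers : ∀ x Js → JoinRepresentation (AR D) x Js → CoversDescents x Js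
  join⇒covers x Js (≤x , least) {u} {v} descent with Any.any? (λ y → rev? y u v) Js
  ... | yes a = a
  ... | no ¬a = ⊥-elim (proj₂ (rev⁻ (flip-biclosed x descent)
    (least (flipArc x descent) (All.tabulate λ {y} → below y) u (proj₁ descent))) (refl , refl))
    where
    below : ∀ y → y ∈ˡ Js → y ≼ flipArc x descent
    below y y∈ a p = rev⁺ (flip-biclosed x descent)
      (All.lookup ≤x y∈ a p , λ { (refl , refl) → ¬a (lose y∈ p) })

  covers⇒join : ∀ x Js → All (_≼ x) Js → CoversDescents x Js →
    JoinRepresentation (AR D) x Js
  covers⇒join x Js ≤x covers = ≤x , least
    where
    least : ∀ z → All (_≼ z) Js → x ≼ z
    least z ≤z u {v} p = decidable-stable (rev? z u v) contra
      where
      contra : ¬ ¬ Rev z u v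
      contra ¬q with missing-descent x (glb x z) (glb≤ˡ x z) p (¬q ∘ glb≤ʳ x z u)
      ... | a , b , descent , ¬m with find (covers descent)
      ...   | y , y∈ , m = ¬m (glb-greatest x z y (All.lookup ≤x y∈) (All.lookup ≤z y∈) a m)

-- Ropes and join irreducibles

module Ropes (D : DAG) (skeletal : Skeletal D) where
  open DAG D
  open Skeleton D skeletal
  open Lattice D skeletal
  open Poset (AR D) using (_≈_) renaming (Carrier to AO; _≤_ to _≼_)
  private module AR = Poset (AR D)

  Quadruple : Set
  Quadruple = V × V × Subset n × Subset n

  opposite : Quadruple → Quadruple
  opposite (u , v , ∇ , Δ) = u , v , Δ , ∇

  -- For the quadruple of a rope, the arcs reversed in its join irreducible.
  JoinArc : Quadruple → Rel V 0ℓ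
  JoinArc (u , v , ∇ , Δ) a b =
    a ⟶ b × a ∈ Δ ∪ (⁅ u ⁆ ∪ ⁅ v ⁆) × b ∈ ∇ ∪ (⁅ u ⁆ ∪ ⁅ v ⁆)

  joinArc? : ∀ q a b → Dec (JoinArc q a b)
  joinArc? q a b = arc? a b ×-dec (a ∈? _) ×-dec (b ∈? _)

  MeetArc : Quadruple → Rel V 0ℓ
  MeetArc q = JoinArc (opposite q)

  IsArc : Quadruple → Rel V 0ℓ
  IsArc (u , v , _) a b = a ≡ u × b ≡ v

  isArc? : ∀ q a b → Dec (IsArc q a b)
  isArc? (u , v , _) a b = (a ≟ u) ×-dec (b ≟ v)

  with-ends⁻ : ∀ {p : Subset n} {u v w} → w ∈ p ∪ (⁅ u ⁆ ∪ ⁅ v ⁆) →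
    w ∈ p ⊎ w ≡ u ⊎ w ≡ v
  with-ends⁻ {p} {u} {v} =
    Sum.map₂ (Sum.map (x∈⁅y⁆⇒x≡y u) (x∈⁅y⁆⇒x≡y v) ∘ x∈p∪q⁻ ⁅ u ⁆ ⁅ v ⁆) ∘ x∈p∪q⁻ p _

  inside⁺ : ∀ {p : Subset n} {u v w} → w ∈ p → w ∈ p ∪ (⁅ u ⁆ ∪ ⁅ v ⁆)
  inside⁺ = x∈p∪q⁺ ∘ inj₁

  source⁺ : ∀ {p : Subset n} {u v} → u ∈ p ∪ (⁅ u ⁆ ∪ ⁅ v ⁆)
  source⁺ = x∈p∪q⁺ (inj₂ (x∈p∪q⁺ (inj₁ (x∈⁅x⁆ _))))

  target⁺ : ∀ {p : Subset n} {u v} → v ∈ p ∪ (⁅ u ⁆ ∪ ⁅ v ⁆)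
  target⁺ = x∈p∪q⁺ (inj₂ (x∈p∪q⁺ (inj₂ (x∈⁅x⁆ _))))

  oppositeRope : Rope D → Rope D
  oppositeRope r = record
    { u         = u
    ; v         = v
    ; ∇         = Δ
    ; Δ         = ∇
    ; arc       = arc
    ; disjoint  = subst (λ p → ¬ ∃ (_∈ p)) (∩-comm ∇ Δ) disjoint
    ; partition = λ w → subst (λ p → w ∈ p ⇔ (TransitiveSupport _⟶_ u v w × w ≢ u × w ≢ v))
        (∪-comm ∇ Δ) (partition w)
    }
    where open Rope r

  module _ (r : Rope D) where
    open Rope r

    Between : V → Set
    Between w = u ⟶ w × w ⟶ v

    inside⇒between : ∀ {w} → w ∈ ∇ ⊎ w ∈ Δ → Between w
    inside⇒between {w} w∈ =
      let π , w≢u , w≢v = Equivalence.to (partition w) (x∈p∪q⁺ w∈)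
      in support⇒between arc π w≢u w≢v

    between⇒inside : ∀ {w} → Between w → w ∈ ∇ ⊎ w ∈ Δ
    between⇒inside {w} (uw , wv) = x∈p∪q⁻ ∇ Δ (Equivalence.from (partition w)
      ((uw ◅ wv ◅ ε , there (here refl)) , ⟶⇒≢ uw ∘ sym , ⟶⇒≢ wv))

    ∇Δ-disjoint : ∀ {w} → w ∈ ∇ → ¬ w ∈ Δ
    ∇Δ-disjoint w∈∇ w∈Δ = disjoint (_ , x∈p∩q⁺ (w∈∇ , w∈Δ))

    Within : V → Set
    Within w = Between w ⊎ w ≡ u ⊎ w ≡ v

    within-adj : ∀ {w w′} → Within w → Within w′ → w ≢ w′ → Adj w w′
    within-adj (inj₁ (uw , wv)) (inj₁ (uw′ , w′v)) ≢ = between-total uw wv uw′ w′v ≢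
    within-adj (inj₁ (uw , wv)) (inj₂ (inj₁ refl)) ≢ = bwd uw
    within-adj (inj₁ (uw , wv)) (inj₂ (inj₂ refl)) ≢ = fwd wv
    within-adj (inj₂ (inj₁ refl)) (inj₁ (uw , wv)) ≢ = fwd uw
    within-adj (inj₂ (inj₂ refl)) (inj₁ (uw , wv)) ≢ = bwd wv
    within-adj (inj₂ (inj₁ refl)) (inj₂ (inj₁ refl)) ≢ = contradiction refl ≢
    within-adj (inj₂ (inj₁ refl)) (inj₂ (inj₂ refl)) ≢ = fwd arc
    within-adj (inj₂ (inj₂ refl)) (inj₂ (inj₁ refl)) ≢ = bwd arc
    within-adj (inj₂ (inj₂ refl)) (inj₂ (inj₂ refl)) ≢ = contradiction refl ≢

    ∇-within : ∀ {w} → w ∈ ∇ ∪ ends → Within w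
    ∇-within = Sum.map₁ (inside⇒between ∘ inj₁) ∘ with-ends⁻

    Δ-within : ∀ {w} → w ∈ Δ ∪ ends → Within w
    Δ-within = Sum.map₁ (inside⇒between ∘ inj₂) ∘ with-ends⁻

    joinArc-source : ∀ {a b} → JoinArc quadruple a b → a ∈ Δ ⊎ a ≡ u
    joinArc-source (e , a∈ , b∈) with with-ends⁻ a∈ | ∇-within b∈
    ... | inj₁ a∈Δ         | _                  = inj₁ a∈Δ
    ... | inj₂ (inj₁ a≡u)  | _                  = inj₂ a≡u
    ... | inj₂ (inj₂ refl) | inj₁ (_ , bv)      = ⊥-elim (no-2-cycle bv e)
    ... | inj₂ (inj₂ refl) | inj₂ (inj₁ refl)   = ⊥-elim (no-2-cycle arc e)
    ... | inj₂ (inj₂ refl) | inj₂ (inj₂ refl)   = ⊥-elim (no-loop e)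

    joinArc-target : ∀ {a b} → JoinArc quadruple a b → b ∈ ∇ ⊎ b ≡ v
    joinArc-target (e , a∈ , b∈) with with-ends⁻ b∈ | Δ-within a∈
    ... | inj₁ b∈∇         | _                  = inj₁ b∈∇
    ... | inj₂ (inj₂ b≡v)  | _                  = inj₂ b≡v
    ... | inj₂ (inj₁ refl) | inj₁ (ua , _)      = ⊥-elim (no-2-cycle ua e)
    ... | inj₂ (inj₁ refl) | inj₂ (inj₁ refl)   = ⊥-elim (no-loop e)
    ... | inj₂ (inj₁ refl) | inj₂ (inj₂ refl)   = ⊥-elim (no-2-cycle arc e)

  module _ (r : Rope D) where
    open Rope r

    joinArc∩meetArc : ∀ {a b} → JoinArc quadruple a b → MeetArc quadruple a b →
      IsArc quadruple a b
    joinArc∩meetArc p q = source , target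
      where
      source : _ ≡ u
      source with joinArc-source r p | joinArc-source (oppositeRope r) q
      ... | inj₁ a∈Δ | inj₁ a∈∇ = ⊥-elim (∇Δ-disjoint r a∈∇ a∈Δ)
      ... | inj₂ a≡u | _        = a≡u
      ... | _        | inj₂ a≡u = a≡u
      target : _ ≡ v
      target with joinArc-target r p | joinArc-target (oppositeRope r) q
      ... | inj₁ a∈∇ | inj₁ a∈Δ = ⊥-elim (∇Δ-disjoint r a∈∇ a∈Δ)
      ... | inj₂ a≡v | _        = a≡v
      ... | _        | inj₂ a≡v = a≡v

    joinArc-biclosed : Biclosed (JoinArc quadruple)
    joinArc-biclosed = record
      { X?         = joinArc? quadruple
      ; X⇒⟶        = proj₁
      ; X-closed   = λ _ p q → ⊥-elim (no-composition (joinArc-target r p) (joinArc-source r q))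
      ; X-coclosed = split-arc
      }
      where
      no-composition : ∀ {b} → b ∈ ∇ ⊎ b ≡ v → ¬ (b ∈ Δ ⊎ b ≡ u)
      no-composition (inj₁ b∈∇)  (inj₁ b∈Δ)  = ∇Δ-disjoint r b∈∇ b∈Δ
      no-composition (inj₁ b∈∇)  (inj₂ refl) = no-loop (proj₁ (inside⇒between r (inj₁ b∈∇)))
      no-composition (inj₂ refl) (inj₁ b∈Δ)  = no-loop (proj₂ (inside⇒between r (inj₂ b∈Δ)))
      no-composition (inj₂ refl) (inj₂ refl) = no-loop arc
      split-arc : ∀ {a b c} → a ⟶ b → b ⟶ c → JoinArc quadruple a c →
        JoinArc quadruple a b ⊎ JoinArc quadruple b c
      split-arc {a} {b} {c} ab bc p@(_ , a∈ , c∈) =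
        Sum.map (λ b∈∇ → ab , a∈ , inside⁺ b∈∇) (λ b∈Δ → bc , inside⁺ b∈Δ , c∈)
          (between⇒inside r (support⇒between arc
            (ua ◅◅ ab ◅ bc ◅ cv , ∈-◅◅ʳ ua (ab ◅ bc ◅ cv) (there (here refl)))
            (λ { refl → no-return ua ab }) (λ { refl → no-return cv bc })))
        where
        ua : Path _⟶_ u a
        ua with joinArc-source r p
        ... | inj₁ a∈Δ  = proj₁ (inside⇒between r (inj₂ a∈Δ)) ◅ ε
        ... | inj₂ refl = ε
        cv : Path _⟶_ c v
        cv with joinArc-target r p
        ... | inj₁ c∈∇  = proj₂ (inside⇒between r (inj₁ c∈∇)) ◅ ε
        ... | inj₂ refl = ε

    ji : AO
    ji = fromBiclosed joinArc-biclosed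

    ji⁺ : ∀ {a b} → JoinArc quadruple a b → Rev ji a b
    ji⁺ = rev⁺ joinArc-biclosed

    ji⁻ : ∀ {a b} → Rev ji a b → JoinArc quadruple a b
    ji⁻ = rev⁻ joinArc-biclosed

    arc-joinArc : JoinArc quadruple u v
    arc-joinArc = arc , source⁺ , target⁺

    ∇-joinArc : ∀ {b} → b ∈ ∇ → JoinArc quadruple u b
    ∇-joinArc b∈ = proj₁ (inside⇒between r (inj₁ b∈)) , source⁺ , inside⁺ b∈

    Δ-joinArc : ∀ {a} → a ∈ Δ → JoinArc quadruple a v
    Δ-joinArc a∈ = proj₂ (inside⇒between r (inj₂ a∈)) , inside⁺ a∈ , target⁺

  Avoids : AO → Quadruple → Set
  Avoids x q = ∀ {a b} → MeetArc q a b → Rev x a b → IsArc q a b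

  DescentRope : AO → Quadruple → Set
  DescentRope x q@(u , v , _) = Descent x u v × Avoids x q

  module _ (x : AO) (r : Rope D) where
    open Rope r

    ji-minimal : Rev x u v → Avoids x quadruple → ji r ≼ x
    ji-minimal uv avoids a {b} p = reversed-arc (joinArc-source r q) (joinArc-target r q)
      where
      q = ji⁻ r p
      ub : b ∈ ∇ → Rev x u b
      ub b∈ with coclosed x (proj₁ bt) (proj₂ bt) uv
        where bt = inside⇒between r (inj₁ b∈)
      ... | inj₁ p = p
      ... | inj₂ p with avoids (Δ-joinArc (oppositeRope r) b∈) p
      ...   | refl , _ = ⊥-elim (no-loop (proj₁ (inside⇒between r (inj₁ b∈))))
      ¬ua : a ∈ Δ → ¬ Rev x u a
      ¬ua a∈ p with avoids (∇-joinArc (oppositeRope r) a∈) p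
      ... | _ , refl = no-loop (proj₂ (inside⇒between r (inj₂ a∈)))
      from-u : ∀ {c} → a ∈ Δ → a ⟶ c → Rev x u c → Rev x a c
      from-u a∈ ac uc with coclosed x (proj₁ (inside⇒between r (inj₂ a∈))) ac uc
      ... | inj₁ p = ⊥-elim (¬ua a∈ p)
      ... | inj₂ p = p
      reversed-arc : a ∈ Δ ⊎ a ≡ u → b ∈ ∇ ⊎ b ≡ v → Rev x a b
      reversed-arc (inj₂ refl) (inj₂ refl) = uv
      reversed-arc (inj₂ refl) (inj₁ b∈)   = ub b∈
      reversed-arc (inj₁ a∈)   (inj₂ refl) = from-u a∈ (proj₁ q) uv
      reversed-arc (inj₁ a∈)   (inj₁ b∈)   = from-u a∈ (proj₁ q) (ub b∈)

    module _ (d : DescentRope x quadruple) where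

      ji≼ : ji r ≼ x
      ji≼ = ji-minimal (proj₁ (proj₁ d)) (proj₂ d)

      meetArc⇒dir : ∀ {a b} → MeetArc quadruple a b → ¬ IsArc quadruple a b → Dir x a b
      meetArc⇒dir m ≢uv = inj₁ (proj₁ m , ≢uv ∘ proj₂ d m)

      joinArc⇒dir : ∀ {a b} → JoinArc quadruple a b → Dir x b a
      joinArc⇒dir p = rev⇒dir x (ji≼ _ (ji⁺ r p))

      only-descent : ∀ {a b} → JoinArc quadruple a b → Flippable x a b → IsArc quadruple a b
      only-descent {a} {b} p@(ab , a∈ , b∈) flippable = source , target
        where
        source : a ≡ u
        source with joinArc-source r p
        ... | inj₂ a≡u = a≡u
        ... | inj₁ a∈Δ = ⊥-elim (flippable
          (joinArc⇒dir (fill-from (joinArc-target r p) , source⁺ , b∈))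
          (meetArc⇒dir (∇-joinArc (oppositeRope r) a∈Δ)
            λ { (_ , refl) → no-loop (proj₂ (inside⇒between r (inj₂ a∈Δ))) }))
          where
          fill-from : b ∈ ∇ ⊎ b ≡ v → u ⟶ b
          fill-from (inj₁ b∈∇)  = proj₁ (inside⇒between r (inj₁ b∈∇))
          fill-from (inj₂ refl) = arc
        target : b ≡ v
        target with joinArc-target r p
        ... | inj₂ b≡v = b≡v
        ... | inj₁ b∈∇ = ⊥-elim (flippable
          (meetArc⇒dir (Δ-joinArc (oppositeRope r) b∈∇)
            λ { (refl , _) → no-loop (proj₁ (inside⇒between r (inj₁ b∈∇))) })
          (joinArc⇒dir (fill-to (joinArc-source r p) , a∈ , target⁺)))
          where
          fill-to : a ∈ Δ ⊎ a ≡ u → a ⟶ v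
          fill-to (inj₁ a∈Δ)  = proj₂ (inside⇒between r (inj₂ a∈Δ))
          fill-to (inj₂ refl) = arc

  ji-descentRope : ∀ r → DescentRope (ji r) (Rope.quadruple r)
  ji-descentRope r = (ji⁺ r (arc-joinArc r) , flippable) , λ m p → joinArc∩meetArc r (ji⁻ r p) m
    where
    open Rope r
    flippable : Flippable (ji r) u v
    flippable (inj₁ (vw , _)) (inj₁ (wu , _)) = no-3-cycle arc vw wu
    flippable (inj₁ (vw , _)) (inj₂ (_ , p)) with joinArc-target r (ji⁻ r p)
    ... | inj₁ w∈   = no-2-cycle vw (proj₂ (inside⇒between r (inj₁ w∈)))
    ... | inj₂ refl = no-loop vw
    flippable (inj₂ (_ , p)) (inj₁ (wu , _)) with joinArc-source r (ji⁻ r p)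
    ... | inj₁ w∈   = no-2-cycle wu (proj₁ (inside⇒between r (inj₂ w∈)))
    ... | inj₂ refl = no-loop wu
    flippable (inj₂ (_ , p)) (inj₂ (_ , q))
      with joinArc-source r (ji⁻ r p) | joinArc-target r (ji⁻ r q)
    ... | inj₁ w∈Δ  | inj₁ w∈∇  = ∇Δ-disjoint r w∈∇ w∈Δ
    ... | inj₂ refl | _         = no-loop (rev⇒arc (ji r) q)
    ... | _         | inj₂ refl = no-loop (rev⇒arc (ji r) p)

  ≼-antisym : ∀ x y → x ≼ y → y ≼ x → x ≈ y
  ≼-antisym x y = AR.antisym {x} {y}

  ≈⇒≼ : ∀ x y → x ≈ y → x ≼ y
  ≈⇒≼ x y = AR.reflexive {x} {y}

  ≈⇒≽ : ∀ x y → x ≈ y → y ≼ x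
  ≈⇒≽ x y x≈y = AR.reflexive {y} {x} (sym ∘ x≈y)

  open Setoid (ropeSetoid D) using () renaming (_≈_ to _≈ᴿ_)

  ji-cong : ∀ r r′ → r ≈ᴿ r′ → ji r ≈ ji r′
  ji-cong r r′ r≈r′ = ≼-antisym (ji r) (ji r′)
    (λ a {b} p → ji⁺ r′ (subst (λ q → JoinArc q a b) r≈r′ (ji⁻ r p)))
    (λ a {b} p → ji⁺ r (subst (λ q → JoinArc q a b) (sym r≈r′) (ji⁻ r′ p)))

  descentRope-unique : ∀ x r r′ →
    DescentRope x (Rope.quadruple r) → DescentRope x (Rope.quadruple r′) →
    IsArc (Rope.quadruple r) (Rope.u r′) (Rope.v r′) → ji r ≈ ji r′
  descentRope-unique x r r′ d d′ (refl , refl) = ≼-antisym (ji r) (ji r′)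
    (ji-minimal (ji r′) r (ji⁺ r′ (arc-joinArc r′)) (λ m → proj₂ d m ∘ ji≼ x r′ d′ _))
    (ji-minimal (ji r) r′ (ji⁺ r (arc-joinArc r)) (λ m → proj₂ d′ m ∘ ji≼ x r d _))

  ji-injective : ∀ r r′ → ji r ≈ ji r′ → r ≈ᴿ r′
  ji-injective r r′ r≈r′ = same-arc (only-descent (ji r) r (ji-descentRope r)
      (ji⁻ r (r≽r′ _ (ji⁺ r′ (arc-joinArc r′)))) flippable)
    where
    module r  = Rope r
    module r′ = Rope r′
    r≼r′ : ji r ≼ ji r′
    r≼r′ = ≈⇒≼ (ji r) (ji r′) r≈r′
    r≽r′ : ji r′ ≼ ji r
    r≽r′ = ≈⇒≽ (ji r) (ji r′) r≈r′
    flippable : Flippable (ji r) r′.u r′.v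
    flippable vw wu = proj₂ (proj₁ (ji-descentRope r′)) (transport vw) (transport wu)
      where
      transport : ∀ {a b} → Dir (ji r) a b → Dir (ji r′) a b
      transport (inj₁ (e , ¬p)) = inj₁ (e , ¬p ∘ r≽r′ _)
      transport (inj₂ (e , p))  = inj₂ (e , r≼r′ _ p)
    ∇⊆ : ∀ r r′ → IsArc (Rope.quadruple r) (Rope.u r′) (Rope.v r′) → ji r ≼ ji r′ →
      Rope.∇ r ⊆ Rope.∇ r′
    ∇⊆ r r′ (refl , refl) le w∈ with joinArc-target r′ (ji⁻ r′ (le _ (ji⁺ r (∇-joinArc r w∈))))
    ... | inj₁ w∈′  = w∈′
    ... | inj₂ refl = ⊥-elim (no-loop (proj₂ (inside⇒between r (inj₁ w∈))))
    Δ⊆ : ∀ r r′ → IsArc (Rope.quadruple r) (Rope.u r′) (Rope.v r′) → ji r ≼ ji r′ →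
      Rope.Δ r ⊆ Rope.Δ r′
    Δ⊆ r r′ (refl , refl) le w∈ with joinArc-source r′ (ji⁻ r′ (le _ (ji⁺ r (Δ-joinArc r w∈))))
    ... | inj₁ w∈′  = w∈′
    ... | inj₂ refl = ⊥-elim (no-loop (proj₁ (inside⇒between r (inj₂ w∈))))
    same-arc : IsArc r.quadruple r′.u r′.v → r.quadruple ≡ r′.quadruple
    same-arc uv@(u≡ , v≡) = cong₂ _,_ (sym u≡) (cong₂ _,_ (sym v≡) (cong₂ _,_
      (⊆-antisym (∇⊆ r r′ uv r≼r′) (∇⊆ r′ r (sym u≡ , sym v≡) r≽r′))
      (⊆-antisym (Δ⊆ r r′ uv r≼r′) (Δ⊆ r′ r (sym u≡ , sym v≡) r≽r′))))

  module _ (x : AO) {u v : V} (descent : Descent x u v) where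
    private
      uv : Rev x u v
      uv = proj₁ descent

      Before After : V → Set
      Before w = (u ⟶ w × w ⟶ v) × Rev x u w
      After  w = (u ⟶ w × w ⟶ v) × ¬ Rev x u w

      before? : ∀ w → Dec (Before w)
      before? w = (arc? u w ×-dec arc? w v) ×-dec rev? x u w

      after? : ∀ w → Dec (After w)
      after? w = (arc? u w ×-dec arc? w v) ×-dec ¬? (rev? x u w)

      ∇ Δ : Subset n
      ∇ = select before?
      Δ = select after?

    descentRope : Rope D
    descentRope = record
      { u         = u
      ; v         = v
      ; ∇         = ∇
      ; Δ         = Δ
      ; arc       = rev⇒arc x uv
      ; disjoint  = λ (w , w∈) → let w∈∇ , w∈Δ = x∈p∩q⁻ ∇ Δ w∈ in
          proj₂ (∈-select⁻ after? w∈Δ) (proj₂ (∈-select⁻ before? w∈∇))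
      ; partition = λ w → mk⇔
          (λ w∈ → support ([ proj₁ ∘ ∈-select⁻ before? , proj₁ ∘ ∈-select⁻ after? ]′
            (x∈p∪q⁻ ∇ Δ w∈)))
          (λ (π , w≢u , w≢v) → x∈p∪q⁺
            (classify (support⇒between (rev⇒arc x uv) π w≢u w≢v)))
      }
      where
      support : ∀ {w} → u ⟶ w × w ⟶ v → TransitiveSupport _⟶_ u v w × w ≢ u × w ≢ v
      support (uw , wv) = (uw ◅ wv ◅ ε , there (here refl)) , ⟶⇒≢ uw ∘ sym , ⟶⇒≢ wv
      classify : ∀ {w} → u ⟶ w × w ⟶ v → w ∈ ∇ ⊎ w ∈ Δ
      classify {w} bt with rev? x u w
      ... | yes p = inj₁ (∈-select⁺ before? (bt , p))
      ... | no ¬p = inj₂ (∈-select⁺ after? (bt , ¬p))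

    descentRope-isDescentRope : DescentRope x (Rope.quadruple descentRope)
    descentRope-isDescentRope = descent , λ m p →
      avoids p (joinArc-source (oppositeRope descentRope) m)
        (joinArc-target (oppositeRope descentRope) m)
      where
      avoids : ∀ {a b} → Rev x a b → a ∈ ∇ ⊎ a ≡ u → b ∈ Δ ⊎ b ≡ v → a ≡ u × b ≡ v
      avoids p (inj₂ refl) (inj₂ refl) = refl , refl
      avoids p (inj₂ refl) (inj₁ b∈)   = ⊥-elim (proj₂ (∈-select⁻ after? b∈) p)
      avoids p (inj₁ a∈)   (inj₂ refl) = ⊥-elim (proj₂ descent (rev⇒dir x p)
        (rev⇒dir x (proj₂ (∈-select⁻ before? a∈))))
      avoids p (inj₁ a∈)   (inj₁ b∈)   =
        let (ub , _) , ¬ub = ∈-select⁻ after? b∈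
        in ⊥-elim (¬ub (closed x ub (proj₂ (∈-select⁻ before? a∈)) p))

  module _ (r r′ : Rope D) where
    private
      q  = Rope.quadruple r
      q′ = Rope.quadruple r′

    crossing⁺ : ∀ {a b} → MeetArc q a b → JoinArc q′ a b → Crossing D r r′
    crossing⁺ (e , a∈ , b∈) (_ , a∈′ , b∈′) =
      _ , _ , ⟶⇒≢ e , x∈p∩q⁺ (a∈ , a∈′) , x∈p∩q⁺ (b∈ , b∈′)

    crossing⁻ : Crossing D r r′ →
      ∃₂ λ a b → JoinArc q a b × MeetArc q′ a b ⊎ MeetArc q a b × JoinArc q′ a b
    crossing⁻ (w , w′ , w≢w′ , w∈ , w′∈) with x∈p∩q⁻ _ _ w∈ | x∈p∩q⁻ _ _ w′∈
    ... | w∈∇ , w∈Δ′ | w′∈Δ , w′∈∇′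
      with within-adj r (∇-within r w∈∇) (Δ-within r w′∈Δ) w≢w′
    ... | bwd e = _ , _ , inj₁ ((e , w′∈Δ , w∈∇) , (e , w′∈∇′ , w∈Δ′))
    ... | fwd e = _ , _ , inj₂ ((e , w∈∇ , w′∈Δ) , (e , w∈Δ′ , w′∈∇′))

  descentRopes-noncrossing : ∀ x r r′ →
    DescentRope x (Rope.quadruple r) → DescentRope x (Rope.quadruple r′) →
    Crossing D r r′ → ji r ≈ ji r′
  descentRopes-noncrossing x r r′ d d′ crossing with crossing⁻ r r′ crossing
  ... | _ , _ , inj₁ (p , m) with proj₂ d′ m (ji≼ x r d _ (ji⁺ r p))
  ...   | refl , refl = descentRope-unique x r r′ d d′
    (only-descent x r d p (proj₂ (proj₁ d′)))
  descentRopes-noncrossing x r r′ d d′ crossing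
      | _ , _ , inj₂ (m , p) with proj₂ d m (ji≼ x r′ d′ _ (ji⁺ r′ p))
  ...   | refl , refl = sym ∘ descentRope-unique x r′ r d′ d
    (only-descent x r′ d′ p (proj₂ (proj₁ d)))

-- Canonical join representations

module JoinComplex (D : DAG) (skeletal : Skeletal D) where
  open DAG D
  open Lattice D skeletal
  open Ropes D skeletal
  open AcyclicReorientation using (reversed)
  open Poset (AR D) using (_≈_) renaming (Carrier to AO; _≤_ to _≼_)
  private module AR = Poset (AR D)
  open Setoid (ropeSetoid D) using () renaming (_≈_ to _≈ᴿ_)
  open Data.List.Membership.Setoid AR.Eq.setoid using () renaming (_∈_ to _∈ᴸ_)
  open Data.List.Relation.Binary.Subset.Setoid AR.Eq.setoid
    using () renaming (_⊆_ to _⊆ᴸ_; _⊈_ to _⊈ᴸ_)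

  ≈-trans : ∀ x y z → x ≈ y → y ≈ z → x ≈ z
  ≈-trans x y z = AR.Eq.trans {x} {y} {z}

  _≈?_ : ∀ x y → Dec (x ≈ y)
  x ≈? y = all? λ a → ≡-dec Bool._≟_ (reversed x a) (reversed y a)

  IsDescentJoin : AO → AO → Set
  IsDescentJoin x y = ∃ λ r → DescentRope x (Rope.quadruple r) × y ≈ ji r

  isDescentJoin-∈ : ∀ {x Js y} → All (IsDescentJoin x) Js → y ∈ᴸ Js → IsDescentJoin x y
  isDescentJoin-∈ {y = y} all y∈ with find y∈
  ... | z , z∈ , y≈z with All.lookup all z∈
  ...   | r , d , z≈ = r , d , ≈-trans y z (ji r) y≈z z≈

  isDescentJoin-≼ : ∀ x y → IsDescentJoin x y → y ≼ x
  isDescentJoin-≼ x y (r , d , y≈) a p = ji≼ x r d a (≈⇒≼ y (ji r) y≈ a p)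

  isDescentJoin-unique : ∀ x y r → DescentRope x (Rope.quadruple r) →
    IsDescentJoin x y → Rev y (Rope.u r) (Rope.v r) → y ≈ ji r
  isDescentJoin-unique x y r d (r′ , d′ , y≈) p = ≈-trans y (ji r′) (ji r) y≈
    (descentRope-unique x r′ r d′ d (only-descent x r′ d′
      (ji⁻ r′ (≈⇒≼ y (ji r′) y≈ _ p)) (proj₂ (proj₁ d))))

  canonical⁺ : ∀ x Js → All (IsDescentJoin x) Js → CoversDescents x Js →
    CanonicalJoinRepresentation (AR D) x Js
  canonical⁺ x Js all covers = (covers⇒join x Js below covers , irredundant) , refines
    where
    below : All (_≼ x) Js
    below = All.map (λ {y} → isDescentJoin-≼ x y) all
    irredundant : ∀ Ks → Ks ⊆ᴸ Js → Js ⊈ᴸ Ks → ¬ JoinRepresentation (AR D) x Ks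
    irredundant Ks Ks⊆Js Js⊈Ks rep = Js⊈Ks λ {y} → included y
      where
      included : ∀ y → y ∈ᴸ Js → y ∈ᴸ Ks
      included y y∈ with isDescentJoin-∈ {x} {Js} {y} all y∈
      ... | r , d , y≈ with find (join⇒covers x Ks rep (proj₁ d))
      ...   | z , z∈ , p = lose z∈ (≈-trans y (ji r) z y≈ (sym ∘
        isDescentJoin-unique x z r d
          (isDescentJoin-∈ {x} {Js} {z} all (Ks⊆Js {z} (lose z∈ (λ _ → refl)))) p))
    refines : ∀ Ks → IrredundantJoinRepresentation (AR D) x Ks → _Refines_ (AR D) Js Ks
    refines Ks (rep , _) = All.map (λ {y} → refine y) all
      where
      refine : ∀ y → IsDescentJoin x y → Any (y ≼_) Ks
      refine y (r , d , y≈) with find (join⇒covers x Ks rep (proj₁ d))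
      ... | z , z∈ , p = lose z∈ λ a q → ji-minimal z r p
        (λ m → proj₂ d m ∘ All.lookup (proj₁ rep) z∈ _) a (≈⇒≼ y (ji r) y≈ a q)

  module _ (x : AO) where

    flippable? : ∀ u v → Dec (Flippable x u v)
    flippable? u v with bypass? x u v
    ... | yes (_ , vt , tu) = no λ (flippable : Flippable x u v) → flippable vt tu
    ... | no ¬t             = yes λ vt tu → ¬t (_ , vt , tu)

    descent? : ∀ u v → Dec (Descent x u v)
    descent? u v = rev? x u v ×-dec flippable? u v

    descentJoin : V × V → List AO
    descentJoin (u , v) with descent? u v
    ... | yes d = ji (descentRope x d) ∷ []
    ... | no _  = []

    private
      pairs : List (V × V)
      pairs = cartesianProduct (allFin n) (allFin n)

    abstract
      descentJoins : List AO
      descentJoins = concatMap descentJoin pairs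

      descentJoins-all : All (IsDescentJoin x) descentJoins
      descentJoins-all = All.concat⁺ (All.map⁺ (All.universal single pairs))
        where
        single : ∀ uv → All (IsDescentJoin x) (descentJoin uv)
        single (u , v) with descent? u v
        ... | yes d = (descentRope x d , descentRope-isDescentRope x d , λ _ → refl) ∷ []
        ... | no _  = []

      descentJoins-cover : CoversDescents x descentJoins
      descentJoins-cover {u} {v} d = Any.concat⁺ (Any.map⁺
        (lose (∈-cartesianProduct⁺ (∈-allFin u) (∈-allFin v)) single))
        where
        single : Any (λ y → Rev y u v) (descentJoin (u , v))
        single with descent? u v
        ... | yes d′ = here (ji⁺ (descentRope x d′) (arc-joinArc (descentRope x d′)))
        ... | no ¬d  = contradiction d ¬d

    descentJoins-canonical : CanonicalJoinRepresentation (AR D) x descentJoins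
    descentJoins-canonical = canonical⁺ x descentJoins descentJoins-all descentJoins-cover

  canonical⁻ : ∀ x Js → CanonicalJoinRepresentation (AR D) x Js → All (IsDescentJoin x) Js
  canonical⁻ x Js ((rep , irredundant) , refines) = All.tabulate λ {y} → descent-join y
    where
    Ds = descentJoins x
    included : ∀ z → z ∈ᴸ Ds → z ∈ᴸ Js
    included z z∈ =
      let r , d , z≈  = isDescentJoin-∈ {x} {Ds} {z} (descentJoins-all x) z∈
          y , y∈ , p  = find (join⇒covers x Js rep (proj₁ d))
          w , w∈ , y≼w = find (All.lookup (refines Ds (proj₁ (descentJoins-canonical x))) y∈)
          w≈ = isDescentJoin-unique x w r d (All.lookup (descentJoins-all x) w∈) (y≼w _ p)
      in lose y∈ (≈-trans z (ji r) y z≈ (≼-antisym (ji r) y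
           (ji-minimal y r p (λ m → proj₂ d m ∘ All.lookup (proj₁ rep) y∈ _))
           (λ a q → ≈⇒≼ w (ji r) w≈ a (y≼w a q))))
    descent-join : ∀ y → y ∈ˡ Js → IsDescentJoin x y
    descent-join y y∈ with Any.any? (y ≈?_) Ds
    ... | yes y∈Ds = isDescentJoin-∈ {x} {Ds} {y} (descentJoins-all x) y∈Ds
    ... | no y∉Ds  = contradiction (proj₁ (proj₁ (descentJoins-canonical x)))
      (irredundant Ds (λ {z} → included z) λ Js⊆Ds → y∉Ds (Js⊆Ds {y} (lose y∈ λ _ → refl)))

  ji-irreducible : ∀ r → JoinIrreducible (AR D) (ji r)
  ji-irreducible r Js rep with find (join⇒covers (ji r) Js rep (proj₁ (ji-descentRope r)))
  ... | y , y∈ , p = lose y∈ (≼-antisym (ji r) y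
    (ji-minimal y r p (λ m → proj₂ (ji-descentRope r) m ∘ All.lookup (proj₁ rep) y∈ _))
    (All.lookup (proj₁ rep) y∈))

  irreducible⇒rope : ((x , _) : ∃ (JoinIrreducible (AR D))) → ∃ λ r → x ≈ ji r
  irreducible⇒rope (x , irreducible) =
    let r , _ , x≈ = isDescentJoin-∈ {x} {descentJoins x} {x} (descentJoins-all x)
          (irreducible (descentJoins x) (proj₁ (proj₁ (descentJoins-canonical x))))
    in r , x≈

  rope : ∃ (JoinIrreducible (AR D)) → Rope D
  rope = proj₁ ∘ irreducible⇒rope

  ≈ji-rope : ∀ s → proj₁ s ≈ ji (rope s)
  ≈ji-rope s = proj₂ (irreducible⇒rope s)

  ≈ji⇒≈rope : ∀ r s → proj₁ s ≈ ji r → rope s ≈ᴿ r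
  ≈ji⇒≈rope r s s≈ = ji-injective (rope s) r
    (≈-trans (ji (rope s)) (proj₁ s) (ji r) (sym ∘ ≈ji-rope s) s≈)

  irreducible↔rope : Inverse (Complex.Vertices (canonicalJoinComplex (AR D))) (ropeSetoid D)
  irreducible↔rope = record
    { to        = rope
    ; from      = λ r → ji r , ji-irreducible r
    ; to-cong   = λ {s} {t} s≈t →
        ≈ji⇒≈rope (rope t) s (≈-trans (proj₁ s) (proj₁ t) (ji (rope t)) s≈t (≈ji-rope t))
    ; from-cong = λ {r} {r′} → ji-cong r r′
    ; inverse   = (λ {r} {s} → ≈ji⇒≈rope r s) ,
        (λ {s} {r} r≈s → ≈-trans (ji r) (ji (rope s)) (proj₁ s)
          (ji-cong r (rope s) r≈s) (sym ∘ ≈ji-rope s))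
    }

  module _ (S : List (∃ (JoinIrreducible (AR D)))) where

    private
      Js : List AO
      Js = map proj₁ S

    face⇒noncrossing : ∀ x → CanonicalJoinRepresentation (AR D) x Js →
      NonCrossing D (map rope S)
    face⇒noncrossing x canonical r r′ r∈ r′∈ r≉r′ crossing =
      r≉r′ (ji-injective r r′ (descentRopes-noncrossing x r r′
        (isDescentRope r r∈) (isDescentRope r′ r′∈) crossing))
      where
      isDescentRope : ∀ r → Any (r ≈ᴿ_) (map rope S) → DescentRope x (Rope.quadruple r)
      isDescentRope r r∈ =
        let s , s∈ , r≈ = find (Any.map⁻ r∈)
            r′ , d , s≈ = All.lookup (canonical⁻ x Js canonical) (∈-map⁺ proj₁ s∈)
        in subst (DescentRope x) (sym (trans r≈ (≈ji⇒≈rope r′ s s≈))) d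

    module _ (noncrossing : NonCrossing D (map rope S)) where
      private
        x : AO
        x = lub Js

        x-join : JoinRepresentation (AR D) x Js
        x-join = lub-join Js

      ∈S⇒∈ : ∀ {s} → s ∈ˡ S → Any (rope s ≈ᴿ_) (map rope S)
      ∈S⇒∈ s∈ = Any.map⁺ (lose s∈ refl)

      module _ {s} (s∈ : s ∈ˡ S) where
        private
          r : Rope D
          r = rope s

          q : Quadruple
          q = Rope.quadruple r

          m : AO
          m = ji (oppositeRope r)

        shared⇒≈ : ∀ {s′} → s′ ∈ˡ S → ∀ {a b} →
          JoinArc (Rope.quadruple (rope s′)) a b → MeetArc q a b → ¬ ¬ r ≈ᴿ rope s′
        shared⇒≈ {s′} s′∈ p p′ r≉ = noncrossing r (rope s′) (∈S⇒∈ s∈) (∈S⇒∈ s′∈) r≉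
          (crossing⁺ r (rope s′) p′ p)

        shared⇒arc : ∀ {s′} → s′ ∈ˡ S → ∀ {a b} →
          JoinArc (Rope.quadruple (rope s′)) a b → MeetArc q a b → IsArc q a b
        shared⇒arc s′∈ {a} {b} p p′ = decidable-stable (isArc? q a b) λ ≢uv →
          shared⇒≈ s′∈ p p′ λ r≈ → ≢uv (joinArc∩meetArc r
            (subst (λ q → JoinArc q a b) (sym r≈) p) p′)

        ji≼x : ∀ {s′} → s′ ∈ˡ S → ji (rope s′) ≼ x
        ji≼x {s′} s′∈ a p = All.lookup (proj₁ x-join) (∈-map⁺ proj₁ s′∈) a
          (≈⇒≽ (proj₁ s′) (ji (rope s′)) (≈ji-rope s′) a p)

        arc∈x : Rev x (Rope.u r) (Rope.v r)
        arc∈x = ji≼x s∈ _ (ji⁺ r (arc-joinArc r))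

        x-avoids : Avoids x q
        x-avoids {a} {b} p′ p = decidable-stable (isArc? q a b) λ ≢uv →
          reverse⁻ m* (proj₂ x-join (reverse m*) (All.map⁺ (All.tabulate below)) a p)
            (rev⁺ (flip-biclosed m d) (ji⁺ (oppositeRope r) p′ , ≢uv))
          where
          d = proj₁ (ji-descentRope (oppositeRope r))
          m* = flipArc m d
          below : ∀ {s′} → s′ ∈ˡ S → proj₁ s′ ≼ reverse m*
          below {s′} s′∈ a {b} p = reverse⁺ m* (rev⇒arc (proj₁ s′) p) λ p* →
            let p′ , ≢uv = rev⁻ (flip-biclosed m d) p*
            in ≢uv (shared⇒arc s′∈
                 (ji⁻ (rope s′) (≈⇒≼ (proj₁ s′) (ji (rope s′)) (≈ji-rope s′) a p))
                 (ji⁻ (oppositeRope r) p′))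

        -- x has a descent which is not in the meet w of x with the
        -- complement of m. It lies in ji r′ for some rope r′ of S; unless r′
        -- is r and the descent is its arc, it lies below w.
        x-descent : Descent x (Rope.u r) (Rope.v r)
        x-descent =
          let a , b , d , ab∉w = missing-descent x w (glb≤ˡ x (reverse m)) arc∈x arc∉w
              s′ , s′∈ , p     = find (Any.map⁻ (join⇒covers x Js x-join d))
          in is-descent d (decidable-stable (isArc? q a b) (not-exchanged s′∈
               (ji⁻ (rope s′) (≈⇒≼ (proj₁ s′) (ji (rope s′)) (≈ji-rope s′) a p)) ab∉w))
          where
          w : AO
          w = glb x (reverse m)

          arc∉w : ¬ Rev w (Rope.u r) (Rope.v r)
          arc∉w p = reverse⁻ m (glb≤ʳ x (reverse m) _ p)
            (ji⁺ (oppositeRope r) (arc-joinArc (oppositeRope r)))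

          is-descent : ∀ {a b} → Descent x a b → IsArc q a b → Descent x (Rope.u r) (Rope.v r)
          is-descent d (refl , refl) = d

          module _ {s′} (s′∈ : s′ ∈ˡ S) {a b} (p : JoinArc (Rope.quadruple (rope s′)) a b)
            (ab∉w : ¬ Rev w a b) (≢uv : ¬ IsArc q a b) where
            private
              r′ : Rope D
              r′ = rope s′

            unshared : ¬ JoinArc (Rope.quadruple r′) (Rope.u r) (Rope.v r) → ⊥
            unshared uv∉ = ab∉w
              (glb-greatest x (reverse m) (ji r′) (ji≼x s′∈) below _ (ji⁺ r′ p))
              where
              uv∈ : ∀ {c e} → JoinArc (Rope.quadruple r′) c e → IsArc q c e →
                JoinArc (Rope.quadruple r′) (Rope.u r) (Rope.v r)
              uv∈ t (refl , refl) = t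
              below : ji r′ ≼ reverse m
              below c t = reverse⁺ m (rev⇒arc (ji r′) t) λ t′ →
                uv∉ (uv∈ (ji⁻ r′ t) (shared⇒arc s′∈ (ji⁻ r′ t) (ji⁻ (oppositeRope r) t′)))

            unchanged : Descent (ji r′) (Rope.u r) (Rope.v r) → ⊥
            unchanged d = ab∉w (glb-greatest x (reverse m) (flipArc (ji r′) d) below-x below-m _
              (rev⁺ (flip-biclosed (ji r′) d) (ji⁺ r′ p , ≢uv)))
              where
              below-x : flipArc (ji r′) d ≼ x
              below-x c t = ji≼x s′∈ c (proj₁ (rev⁻ (flip-biclosed (ji r′) d) t))
              below-m : flipArc (ji r′) d ≼ reverse m
              below-m c t =
                let t₁ , ≢uv = rev⁻ (flip-biclosed (ji r′) d) t
                in reverse⁺ m (rev⇒arc (ji r′) t₁) λ t′ →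
                     ≢uv (shared⇒arc s′∈ (ji⁻ r′ t₁) (ji⁻ (oppositeRope r) t′))

            not-exchanged : ⊥
            not-exchanged = unshared λ uv∈ →
              shared⇒≈ s′∈ uv∈ (arc-joinArc (oppositeRope r)) λ r≈ →
                unchanged (proj₁ (subst (DescentRope (ji r′)) (sym r≈) (ji-descentRope r′)))

        x-descentJoin : IsDescentJoin x (proj₁ s)
        x-descentJoin = r , (x-descent , x-avoids) , ≈ji-rope s

      noncrossing⇒face : CanonicalJoinRepresentation (AR D) x Js
      noncrossing⇒face = canonical⁺ x Js (All.map⁺ (All.tabulate x-descentJoin))
        (join⇒covers x Js x-join)

  joinComplex≅ropeComplex : canonicalJoinComplex (AR D) ≅ ropeComplex D
  joinComplex≅ropeComplex = record
    { vertexMap = irreducible↔rope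
    ; faces     = λ S → mk⇔ (λ (x , c) → face⇒noncrossing S x c)
                            (λ nc → lub (map proj₁ S) , noncrossing⇒face S nc)
    }

-- Duality

≅-trans : ∀ {K L M} → K ≅ L → L ≅ M → K ≅ M
≅-trans {M = M} K≅L L≅M = record
  { vertexMap = Composition.inverse KL.vertexMap LM.vertexMap
  ; faces     = λ S → subst (λ T → _ ⇔ Complex.IsFace M T) (sym (map-∘ S))
      (LM.faces _ Composition.⇔-∘ KL.faces S)
  }
  where
  module KL = _≅_ K≅L
  module LM = _≅_ L≅M

record OrderIso (P Q : Poset 0ℓ 0ℓ 0ℓ) : Set where
  private
    module P = Poset P
    module Q = Poset Q
  field
    to        : P.Carrier → Q.Carrier
    from      : Q.Carrier → P.Carrier
    to-mono   : ∀ {x y} → x P.≤ y → to x Q.≤ to y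
    from-mono : ∀ {x y} → x Q.≤ y → from x P.≤ from y
    from-to   : ∀ x → from (to x) P.≈ x
    to-from   : ∀ y → to (from y) Q.≈ y

  to-cong : ∀ {x y} → x P.≈ y → to x Q.≈ to y
  to-cong x≈y = Q.antisym (to-mono (P.reflexive x≈y)) (to-mono (P.reflexive (P.Eq.sym x≈y)))

  from-cong : ∀ {x y} → x Q.≈ y → from x P.≈ from y
  from-cong x≈y = P.antisym (from-mono (Q.reflexive x≈y)) (from-mono (Q.reflexive (Q.Eq.sym x≈y)))

OrderIso-sym : ∀ {P Q} → OrderIso P Q → OrderIso Q P
OrderIso-sym i = record
  { to = from ; from = to ; to-mono = from-mono ; from-mono = to-mono
  ; from-to = to-from ; to-from = from-to }
  where open OrderIso i

module _ (P : Poset 0ℓ 0ℓ 0ℓ) where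
  open Poset P using (Carrier; _≈_; reflexive; module Eq)
    renaming (_≤_ to _≼_; trans to ≼-trans)
  open Data.List.Membership.Setoid Eq.setoid using () renaming (_∈_ to _∈ᴸ_)
  open Data.List.Relation.Binary.Subset.Setoid Eq.setoid using () renaming (_⊆_ to _⊆ᴸ_)

  joinRepresentation-resp : ∀ {x y J} → x ≈ y →
    JoinRepresentation P x J → JoinRepresentation P y J
  joinRepresentation-resp x≈y (≤x , least) =
    All.map (λ ≤x → ≼-trans ≤x (reflexive x≈y)) ≤x ,
    λ z ≤z → ≼-trans (reflexive (Eq.sym x≈y)) (least z ≤z)

  irredundant-resp : ∀ {x y J} → x ≈ y →
    IrredundantJoinRepresentation P x J → IrredundantJoinRepresentation P y J
  irredundant-resp x≈y (rep , irredundant) = joinRepresentation-resp x≈y rep ,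
    λ K K⊆J J⊈K → irredundant K K⊆J J⊈K ∘ joinRepresentation-resp (Eq.sym x≈y)

  All-⊆ : ∀ {A : Carrier → Set} {J K} → (∀ {y z} → y ≈ z → A z → A y) →
    K ⊆ᴸ J → All A J → All A K
  All-⊆ resp K⊆J all = All.tabulate λ y∈ →
    let z , z∈ , y≈z = find (K⊆J (lose y∈ Eq.refl)) in resp y≈z (All.lookup all z∈)

  joinRepresentation-⊆ : ∀ {x J K} → J ⊆ᴸ K → K ⊆ᴸ J →
    JoinRepresentation P x J → JoinRepresentation P x K
  joinRepresentation-⊆ J⊆K K⊆J (≤x , least) =
    All-⊆ below K⊆J ≤x , λ z ≤z → least z (All-⊆ below J⊆K ≤z)
    where
    below : ∀ {x y z} → y ≈ z → z ≼ x → y ≼ x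
    below y≈z = ≼-trans (reflexive y≈z)

  canonical-⊆ : ∀ {x J K} → J ⊆ᴸ K → K ⊆ᴸ J →
    CanonicalJoinRepresentation P x J → CanonicalJoinRepresentation P x K
  canonical-⊆ J⊆K K⊆J ((rep , irredundant) , refines) =
    (joinRepresentation-⊆ J⊆K K⊆J rep ,
      λ L L⊆K K⊈L → irredundant L (K⊆J ∘ L⊆K) λ J⊆L → K⊈L (J⊆L ∘ K⊆J)) ,
    λ L irr → All-⊆ (λ y≈z → Any.map (≼-trans (reflexive y≈z))) K⊆J (refines L irr)

module _ {P Q : Poset 0ℓ 0ℓ 0ℓ} (iso : OrderIso P Q) where
  private
    module P = Poset P
    module Q = Poset Q
  open OrderIso iso
  open Data.List.Membership.Setoid P.Eq.setoid using () renaming (_∈_ to _∈ᴾ_)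
  open Data.List.Membership.Setoid Q.Eq.setoid using () renaming (_∈_ to _∈ᵠ_)
  open Data.List.Relation.Binary.Subset.Setoid P.Eq.setoid using () renaming (_⊆_ to _⊆ᴾ_)
  open Data.List.Relation.Binary.Subset.Setoid Q.Eq.setoid using () renaming (_⊆_ to _⊆ᵠ_)

  to≤⇒≤from : ∀ {x y} → to x Q.≤ y → x P.≤ from y
  to≤⇒≤from le = P.trans (P.reflexive (P.Eq.sym (from-to _))) (from-mono le)

  ≤from⇒to≤ : ∀ {x y} → x P.≤ from y → to x Q.≤ y
  ≤from⇒to≤ le = Q.trans (to-mono le) (Q.reflexive (to-from _))

  to-∈ : ∀ {x K} → x ∈ᴾ map from K → to x ∈ᵠ K
  to-∈ x∈ = Any.map (λ x≈ → Q.Eq.trans (to-cong x≈) (to-from _)) (Any.map⁻ x∈)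

  map-to-⊆ : ∀ {J K} → J ⊆ᴾ map from K → map to J ⊆ᵠ K
  map-to-⊆ J⊆ y∈ =
    let x , x∈ , y≈ = find (Any.map⁻ y∈)
    in Any.map (Q.Eq.trans y≈) (to-∈ (J⊆ (lose x∈ P.Eq.refl)))

  joinRepresentation-to : ∀ {x J} →
    JoinRepresentation P x J → JoinRepresentation Q (to x) (map to J)
  joinRepresentation-to (≤x , least) = All.map⁺ (All.map to-mono ≤x) ,
    λ z ≤z → ≤from⇒to≤ (least (from z) (All.map to≤⇒≤from (All.map⁻ ≤z)))

module _ {P Q : Poset 0ℓ 0ℓ 0ℓ} (iso : OrderIso P Q) where
  private
    module P = Poset P
    module Q = Poset Q
  open OrderIso iso
  open Data.List.Relation.Binary.Subset.Setoid P.Eq.setoid using () renaming (_⊆_ to _⊆ᴾ_)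

  joinRepresentation-from : ∀ {x K} →
    JoinRepresentation Q (to x) K → JoinRepresentation P x (map from K)
  joinRepresentation-from =
    joinRepresentation-resp P (from-to _) ∘ joinRepresentation-to (OrderIso-sym iso)

  irredundant-to : ∀ {x J} → IrredundantJoinRepresentation P x J →
    IrredundantJoinRepresentation Q (to x) (map to J)
  irredundant-to (rep , irredundant) = joinRepresentation-to iso rep ,
    λ K K⊆ ⊈K → irredundant (map from K) (map-to-⊆ (OrderIso-sym iso) K⊆)
      (λ J⊆ → ⊈K (map-to-⊆ iso J⊆)) ∘ joinRepresentation-from

  joinIrreducible-to : ∀ {x} → JoinIrreducible P x → JoinIrreducible Q (to x)
  joinIrreducible-to irreducible K rep =
    to-∈ iso (irreducible (map from K) (joinRepresentation-from rep))

  map-from-to-⊆ : ∀ J → map from (map to J) ⊆ᴾ J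
  map-from-to-⊆ J = map-to-⊆ (OrderIso-sym iso) id

  map-from-to-⊇ : ∀ J → J ⊆ᴾ map from (map to J)
  map-from-to-⊇ J x∈ = Any.map⁺ (Any.map⁺
    (Any.map (λ x≈ → P.Eq.trans x≈ (P.Eq.sym (from-to _))) x∈))

module _ {P Q : Poset 0ℓ 0ℓ 0ℓ} (iso : OrderIso P Q) where
  open OrderIso iso

  canonical-to : ∀ {x J} → CanonicalJoinRepresentation P x J →
    CanonicalJoinRepresentation Q (to x) (map to J)
  canonical-to {x} (irr , refines) = irredundant-to iso irr ,
    λ K irrK → All.map⁺ (All.map (Any.map (≤from⇒to≤ iso) ∘ Any.map⁻)
      (refines (map from K)
        (irredundant-resp P (from-to x) (irredundant-to (OrderIso-sym iso) irrK))))

module _ {P Q : Poset 0ℓ 0ℓ 0ℓ} (iso : OrderIso P Q) where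
  private
    module P = Poset P
    module Q = Poset Q
  open OrderIso iso

  canonicalJoinComplex-cong : canonicalJoinComplex P ≅ canonicalJoinComplex Q
  canonicalJoinComplex-cong = record
    { vertexMap = record
      { to        = to-irreducible
      ; from      = λ (y , irr) → from y , joinIrreducible-to (OrderIso-sym iso) irr
      ; to-cong   = to-cong
      ; from-cong = from-cong
      ; inverse   = (λ y≈ → Q.Eq.trans (to-cong y≈) (to-from _)) ,
                    (λ x≈ → P.Eq.trans (from-cong x≈) (from-to _))
      }
    ; faces     = λ S → mk⇔
        (λ (x , c) → to x ,
          subst (CanonicalJoinRepresentation Q (to x)) (map-to S) (canonical-to iso c))
        (λ (y , c) → from y , canonical-⊆ P (map-from-to-⊆ iso (map proj₁ S))
          (map-from-to-⊇ iso (map proj₁ S)) (canonical-to (OrderIso-sym iso)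
            (subst (CanonicalJoinRepresentation Q y) (sym (map-to S)) c)))
    }
    where
    to-irreducible : ∃ (JoinIrreducible P) → ∃ (JoinIrreducible Q)
    to-irreducible (x , irr) = to x , joinIrreducible-to iso irr
    map-to : ∀ S → map to (map proj₁ S) ≡ map proj₁ (map to-irreducible S)
    map-to S = trans (sym (map-∘ S)) (map-∘ S)

module _ (D : DAG) (skeletal : Skeletal D) where
  open Lattice D skeletal

  reverseIso : OrderIso (Flip.poset (AR D)) (AR D)
  reverseIso = record
    { to        = reverse
    ; from      = reverse
    ; to-mono   = λ {x} {y} → reverse-antitone y x
    ; from-mono = λ {x} {y} → reverse-antitone x y
    ; from-to   = reverse-involutive
    ; to-from   = reverse-involutive
    }

corollary31 : ∀ (D : DAG) → Skeletal D →
    canonicalJoinComplex (AR D) ≅ ropeComplex D ×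
    canonicalMeetComplex (AR D) ≅ ropeComplex D
corollary31 D skeletal = join , ≅-trans (canonicalJoinComplex-cong (reverseIso D skeletal)) join
  where
  join : canonicalJoinComplex (AR D) ≅ ropeComplex D
  join = JoinComplex.joinComplex≅ropeComplex D skeletal
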